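{- Let $\mathbf{C}$ be a 0-cell in a (strict) 2-category $\mathcal K$. There is a one-to-one correspondence between: (1) tuples $(S,T,U,r,s)$ where $S,T,U$ are monads on $\mathbf C$ and $r\colon ST\Rightarrow U$, $s\colon U\Rightarrow ST$ form a distributing retraction of $ST$ onto $U$; (2) tuples $(S,T,U,\lambda,r,s)$ where $S$ and $T$ are monads on $\mathbf C$, $U$ is a 1-cell on $\mathbf C$, $\lambda\colon TS\Rightarrow ST$ is a weak distributive law of $S$ over $T$, and $r\colon ST\Rightarrow U$, $s\colon U\Rightarrow ST$ form a splitting of the idempotent $e := S\mu^T\circ\lambda T\circ\eta^T ST$ (i.e. $r\circ s = U$ and $s\circ r = e$). From (1) to (2), $\lambda := s\circ\mu^U\circ ji$, where $i := r\circ S\eta^T$ and $j := r\circ\eta^S T$. From (2) to (1), $\eta^U := r\circ\eta^S\eta^T$ and $\mu^U := r\circ\mu^S\mu^T\circ S\lambda T\circ ss$. In both directions the remaining components are unchanged.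
   Context: Horizontal composition of 1-cells and 2-cells is written by juxtaposition, vertical composition by $\circ$; a 1-cell $F$ also denotes its identity 2-cell; $\mathrm{1}_{\mathbf C}$ is the identity 1-cell. A monad $(T,\eta^T,\mu^T)$ on $\mathbf C$ is a 1-cell $T\colon\mathbf C\to\mathbf C$ with 2-cells $\eta^T\colon 1_{\mathbf C}\Rightarrow T$, $\mu^T\colon TT\Rightarrow T$ such that $\mu^T\circ T\eta^T=T=\mu^T\circ\eta^T T$ and $\mu^T\circ T\mu^T=\mu^T\circ\mu^T T$. For a monad $S$ and a 2-cell $f\colon F\Rightarrow SG$, its extension is $f^{\underline S}:=\mu^S G\circ Sf\colon SF\Rightarrow SG$. A distributing retraction of $ST$ onto $U$ (for monads $S,T,U$ on $\mathbf C$) is a pair of 2-cells $r\colon ST\Rightarrow U$, $s\colon U\Rightarrow ST$ with $r\circ s=U$ such that, with $i:=r\circ S\eta^T\colon S\Rightarrow U$, $j:=r\circ\eta^S T\colon T\Rightarrow U$, $e:=s\circ r\colon ST\Rightarrow ST$: - $r\circ\eta^S\eta^T=\eta^U$; - $r\circ\mu^S T=\mu^U\circ ir$; - $r\circ S\mu^T=\mu^U\circ rj$; - $e\circ\eta^S T=\eta^S T$; - $e\circ S\mu^T=S\mu^T\circ eT$; - $e\circ(s\circ\mu^U\circ jU)^{\underline S}=(s\circ\mu^U\circ jU)^{\underline S}\circ eU$. A weak distributive law of $S$ over $T$ is a 2-cell $\lambda\colon TS\Rightarrow ST$ such that $\lambda\circ T\eta^S=\eta^S T$, $\lambda\circ T\mu^S=\mu^S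 T\circ S\lambda\circ\lambda S$, and $\lambda\circ\mu^T S=S\mu^T\circ\lambda T\circ T\lambda$. -}

module Defs where

open import Level using (Level; _⊔_; suc)
open import Relation.Binary.PropositionalEquality using (_≡_; refl; sym; trans; cong; subst)
open import Relation.Binary.HeterogeneousEquality using (_≅_)

-- Composition of 1-cells is associative and unital up to _≡_.  The corresponding
-- laws for horizontal composition of 2-cells relate 2-cells whose boundaries are
-- equal only propositionally, hence the heterogeneous equality _≅_ in those laws.

record Strict2Category (o ℓ e : Level) : Set (suc (o ⊔ ℓ ⊔ e)) where
  infixr 9 _·_ _⋆_
  infixr 8 _∘_
  infix  4 _⇛_ _⇒_

  field
    Obj : Set o
    _⇛_ : Obj → Obj → Set ℓ
    _⇒_ : ∀ {A B} → A ⇛ B → A ⇛ B → Set e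

    id₁ : ∀ {A} → A ⇛ A
    _·_ : ∀ {A B C} → B ⇛ C → A ⇛ B → A ⇛ C

    identityˡ : ∀ {A B} {F : A ⇛ B} → id₁ · F ≡ F
    identityʳ : ∀ {A B} {F : A ⇛ B} → F · id₁ ≡ F
    assoc     : ∀ {A B C D} {H : C ⇛ D} {G : B ⇛ C} {F : A ⇛ B} →
                (H · G) · F ≡ H · (G · F)

    id₂ : ∀ {A B} {F : A ⇛ B} → F ⇒ F
    _∘_ : ∀ {A B} {F G H : A ⇛ B} → G ⇒ H → F ⇒ G → F ⇒ H
    _⋆_ : ∀ {A B C} {G G′ : B ⇛ C} {F F′ : A ⇛ B} →
          G ⇒ G′ → F ⇒ F′ → G · F ⇒ G′ · F′

    ∘-identityˡ : ∀ {A B} {F G : A ⇛ B} {α : F ⇒ G} → id₂ ∘ α ≡ α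
    ∘-identityʳ : ∀ {A B} {F G : A ⇛ B} {α : F ⇒ G} → α ∘ id₂ ≡ α
    ∘-assoc     : ∀ {A B} {F G H I : A ⇛ B} {γ : H ⇒ I} {β : G ⇒ H} {α : F ⇒ G} →
                  (γ ∘ β) ∘ α ≡ γ ∘ (β ∘ α)

    ⋆-id₂       : ∀ {A B C} {G : B ⇛ C} {F : A ⇛ B} →
                  id₂ {F = G} ⋆ id₂ {F = F} ≡ id₂
    interchange : ∀ {A B C} {G G′ G″ : B ⇛ C} {F F′ F″ : A ⇛ B}
                  {β′ : G′ ⇒ G″} {β : G ⇒ G′} {α′ : F′ ⇒ F″} {α : F ⇒ F′} →
                  (β′ ∘ β) ⋆ (α′ ∘ α) ≡ (β′ ⋆ α′) ∘ (β ⋆ α)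

    ⋆-identityˡ : ∀ {A B} {F F′ : A ⇛ B} {α : F ⇒ F′} →
                  id₂ {F = id₁} ⋆ α ≅ α
    ⋆-identityʳ : ∀ {A B} {F F′ : A ⇛ B} {α : F ⇒ F′} →
                  α ⋆ id₂ {F = id₁} ≅ α
    ⋆-assoc     : ∀ {A B C D} {H H′ : C ⇛ D} {G G′ : B ⇛ C} {F F′ : A ⇛ B}
                  {γ : H ⇒ H′} {β : G ⇒ G′} {α : F ⇒ F′} →
                  (γ ⋆ β) ⋆ α ≅ γ ⋆ (β ⋆ α)

  infixr 8 _∘⟨_⟩_
  infixr 9 _▷_
  infixl 9 _◁_

  -- Vertical composition across a propositional equality of 1-cells; in informal
  -- notation, where bracketings are identified, this is just β ∘ α.
  _∘⟨_⟩_ : ∀ {A B} {F G G′ H : A ⇛ B} → G′ ⇒ H → G ≡ G′ → F ⇒ G → F ⇒ H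
  β ∘⟨ refl ⟩ α = β ∘ α

  _▷_ : ∀ {A B C} (G : B ⇛ C) {F F′ : A ⇛ B} → F ⇒ F′ → G · F ⇒ G · F′
  G ▷ α = id₂ {F = G} ⋆ α

  _◁_ : ∀ {A B C} {G G′ : B ⇛ C} → G ⇒ G′ → (F : A ⇛ B) → G · F ⇒ G′ · F
  β ◁ F = β ⋆ id₂ {F = F}

module _ {o ℓ e} (K : Strict2Category o ℓ e) (C : Strict2Category.Obj K) where
  open Strict2Category K

  record RawMonad : Set (ℓ ⊔ e) where
    constructor rawMonad
    field
      cell : C ⇛ C
      η    : id₁ ⇒ cell
      μ    : cell · cell ⇒ cell

  record IsMonad (M : RawMonad) : Set e where
    open RawMonad M renaming (cell to T)
    field
      unitʳ : μ ∘ (T ▷ η) ≅ id₂ {F = T}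
      unitˡ : μ ∘ (η ◁ T) ≅ id₂ {F = T}
      assocᴹ : μ ∘ (T ▷ μ) ≅ μ ∘ (μ ◁ T)

  record Monad : Set (ℓ ⊔ e) where
    field
      raw     : RawMonad
      isMonad : IsMonad raw
    open RawMonad raw public

module _ {o ℓ e} {K : Strict2Category o ℓ e} {C : Strict2Category.Obj K} where
  open Strict2Category K
  open Monad using (η; μ) renaming (cell to ⟨_⟩)

  extension : (S : Monad K C) {F G : C ⇛ C} → F ⇒ ⟨ S ⟩ · G → ⟨ S ⟩ · F ⇒ ⟨ S ⟩ · G
  extension S {G = G} f = (μ S ◁ G) ∘⟨ sym assoc ⟩ (⟨ S ⟩ ▷ f)

  inclusionˡ : (S T : Monad K C) {U : C ⇛ C} → ⟨ S ⟩ · ⟨ T ⟩ ⇒ U → ⟨ S ⟩ ⇒ U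
  inclusionˡ S T {U} r = subst (_⇒ U) identityʳ (r ∘ (⟨ S ⟩ ▷ η T))

  inclusionʳ : (S T : Monad K C) {U : C ⇛ C} → ⟨ S ⟩ · ⟨ T ⟩ ⇒ U → ⟨ T ⟩ ⇒ U
  inclusionʳ S T {U} r = subst (_⇒ U) identityˡ (r ∘ (η S ◁ ⟨ T ⟩))

  record IsDistributingRetraction (S T U : Monad K C)
      (r : ⟨ S ⟩ · ⟨ T ⟩ ⇒ ⟨ U ⟩) (s : ⟨ U ⟩ ⇒ ⟨ S ⟩ · ⟨ T ⟩) : Set e where
    i : ⟨ S ⟩ ⇒ ⟨ U ⟩
    i = inclusionˡ S T r

    j : ⟨ T ⟩ ⇒ ⟨ U ⟩
    j = inclusionʳ S T r

    idem : ⟨ S ⟩ · ⟨ T ⟩ ⇒ ⟨ S ⟩ · ⟨ T ⟩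
    idem = s ∘ r

    swap : ⟨ T ⟩ · ⟨ U ⟩ ⇒ ⟨ S ⟩ · ⟨ T ⟩
    swap = s ∘ μ U ∘ (j ◁ ⟨ U ⟩)

    field
      retraction   : r ∘ s ≡ id₂
      r-unit       : r ∘ (η S ⋆ η T) ≅ η U
      r-multˡ      : r ∘ (μ S ◁ ⟨ T ⟩) ≅ μ U ∘ (i ⋆ r)
      r-multʳ      : r ∘ (⟨ S ⟩ ▷ μ T) ≅ μ U ∘ (r ⋆ j)
      idem-unit    : idem ∘ (η S ◁ ⟨ T ⟩) ≡ η S ◁ ⟨ T ⟩
      idem-mult    : idem ∘ (⟨ S ⟩ ▷ μ T) ≅ (⟨ S ⟩ ▷ μ T) ∘⟨ assoc ⟩ (idem ◁ ⟨ T ⟩)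
      idem-extends : idem ∘ extension S swap ≅ extension S swap ∘⟨ assoc ⟩ (idem ◁ ⟨ U ⟩)

  record IsWeakDistributiveLaw (S T : Monad K C)
      (law : ⟨ T ⟩ · ⟨ S ⟩ ⇒ ⟨ S ⟩ · ⟨ T ⟩) : Set e where
    field
      law-unit  : law ∘ (⟨ T ⟩ ▷ η S) ≅ η S ◁ ⟨ T ⟩
      law-multˡ : law ∘ (⟨ T ⟩ ▷ μ S)
                ≅ (μ S ◁ ⟨ T ⟩) ∘⟨ sym assoc ⟩ (⟨ S ⟩ ▷ law) ∘⟨ assoc ⟩ (law ◁ ⟨ S ⟩)
      law-multʳ : law ∘ (μ T ◁ ⟨ S ⟩)
                ≅ (⟨ S ⟩ ▷ μ T) ∘⟨ assoc ⟩ (law ◁ ⟨ T ⟩) ∘⟨ sym assoc ⟩ (⟨ T ⟩ ▷ law)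

  lawIdempotent : (S T : Monad K C) → ⟨ T ⟩ · ⟨ S ⟩ ⇒ ⟨ S ⟩ · ⟨ T ⟩ →
                  ⟨ S ⟩ · ⟨ T ⟩ ⇒ ⟨ S ⟩ · ⟨ T ⟩
  lawIdempotent S T law = subst (_⇒ ⟨ S ⟩ · ⟨ T ⟩) identityˡ
    ((⟨ S ⟩ ▷ μ T) ∘⟨ assoc ⟩ (law ◁ ⟨ T ⟩) ∘⟨ sym assoc ⟩ (η T ◁ (⟨ S ⟩ · ⟨ T ⟩)))

  record IsSplitting {F U : C ⇛ C} (idem : F ⇒ F) (r : F ⇒ U) (s : U ⇒ F) : Set e where
    field
      retraction : r ∘ s ≡ id₂
      splits     : s ∘ r ≡ idem

module _ {o ℓ e} (K : Strict2Category o ℓ e) (C : Strict2Category.Obj K) where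
  open Strict2Category K
  open Monad using (η; μ; raw) renaming (cell to ⟨_⟩)

  -- By uniqueness of identity proofs the law fields of the next two records are
  -- propositions, so _≡_ on them is equality of the tuples of data.

  record DistributingRetraction : Set (ℓ ⊔ e) where
    field
      S T U : Monad K C
      r     : ⟨ S ⟩ · ⟨ T ⟩ ⇒ ⟨ U ⟩
      s     : ⟨ U ⟩ ⇒ ⟨ S ⟩ · ⟨ T ⟩
      isDistributingRetraction : IsDistributingRetraction S T U r s

  record SplitWeakDistributiveLaw : Set (ℓ ⊔ e) where
    field
      S T : Monad K C
      U   : C ⇛ C
      law : ⟨ T ⟩ · ⟨ S ⟩ ⇒ ⟨ S ⟩ · ⟨ T ⟩
      r   : ⟨ S ⟩ · ⟨ T ⟩ ⇒ U
      s   : U ⇒ ⟨ S ⟩ · ⟨ T ⟩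
      isWeakDistributiveLaw : IsWeakDistributiveLaw S T law
      isSplitting           : IsSplitting {K = K} (lawIdempotent S T law) r s

  record RetractionData : Set (ℓ ⊔ e) where
    constructor retractionData
    field
      S T : Monad K C
      U   : RawMonad K C
      r   : ⟨ S ⟩ · ⟨ T ⟩ ⇒ RawMonad.cell U
      s   : RawMonad.cell U ⇒ ⟨ S ⟩ · ⟨ T ⟩

  record SplitLawData : Set (ℓ ⊔ e) where
    constructor splitLawData
    field
      S T : Monad K C
      U   : C ⇛ C
      law : ⟨ T ⟩ · ⟨ S ⟩ ⇒ ⟨ S ⟩ · ⟨ T ⟩
      r   : ⟨ S ⟩ · ⟨ T ⟩ ⇒ U
      s   : U ⇒ ⟨ S ⟩ · ⟨ T ⟩

module _ {o ℓ e} {K : Strict2Category o ℓ e} {C : Strict2Category.Obj K} where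
  open Strict2Category K
  open Monad using (η; μ; raw) renaming (cell to ⟨_⟩)

  underlyingRetraction : DistributingRetraction K C → RetractionData K C
  underlyingRetraction x = retractionData S T (raw U) r s
    where open DistributingRetraction x

  underlyingSplitLaw : SplitWeakDistributiveLaw K C → SplitLawData K C
  underlyingSplitLaw y = splitLawData S T U law r s
    where open SplitWeakDistributiveLaw y

  toSplitLawData : DistributingRetraction K C → SplitLawData K C
  toSplitLawData x = splitLawData S T ⟨ U ⟩ (s ∘ μ U ∘ (j ⋆ i)) r s
    where
    open DistributingRetraction x
    open IsDistributingRetraction isDistributingRetraction using (i; j)

  toRetractionData : SplitWeakDistributiveLaw K C → RetractionData K C
  toRetractionData y = retractionData S T (rawMonad U ηᵁ μᵁ) r s
    where
    open SplitWeakDistributiveLaw y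

    ηᵁ : id₁ ⇒ U
    ηᵁ = subst (_⇒ U) identityˡ (r ∘ (η S ⋆ η T))

    rebracket : (⟨ S ⟩ · ⟨ T ⟩) · (⟨ S ⟩ · ⟨ T ⟩) ≡ ⟨ S ⟩ · ((⟨ T ⟩ · ⟨ S ⟩) · ⟨ T ⟩)
    rebracket = trans assoc (cong (⟨ S ⟩ ·_) (sym assoc))

    rebracket′ : ⟨ S ⟩ · ((⟨ S ⟩ · ⟨ T ⟩) · ⟨ T ⟩) ≡ (⟨ S ⟩ · ⟨ S ⟩) · (⟨ T ⟩ · ⟨ T ⟩)
    rebracket′ = trans (cong (⟨ S ⟩ ·_) assoc) (sym assoc)

    μᵁ : U · U ⇒ U
    μᵁ = r ∘ (μ S ⋆ μ T) ∘⟨ rebracket′ ⟩ (⟨ S ⟩ ▷ (law ◁ ⟨ T ⟩)) ∘⟨ rebracket ⟩ (s ⋆ s)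

module Submission where

-- Tensoring 2-cells by juxtaposition makes C ⇛ C a strict monoidal category, and the
-- theorem is a computation in it.  To compute without transporting along the
-- associativity of 1-cells, 1-cells act by composition on the category of 1-cells
-- C ⇛ C (Cayley's embedding): a 2-cell α : F ⇒ G is replaced by its whiskerings
-- α ◁ X, so that S · T acts as S after T and bracketings disappear.  Composites of
-- such components are kept as lists, and ≅⇔≈ says that two 2-cells agree, up to
-- rebracketing, exactly when the lists of their components compose to the same
-- 2-cell at every X.  Each axiom of the definitions is translated once, in both
-- directions, in this way.
--
-- Write e = s ∘ r, i = r ∘ S ηᵀ and j = r ∘ ηˢ T.
--
-- From a law λ, let τ = S μᵀ ∘ λ T : TST ⇒ ST and m = μˢ T ∘ S τ : STST ⇒ ST.
-- Then τ is an action of T (τ-action), so that e = τ ∘ ηᵀ ST satisfies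
-- τ ∘ T e = τ = e ∘ τ; moreover m is associative (m-associative) and
-- e ∘ m = m ∘ e ST (m-absorbs).  It follows that r carries m to μᵁ
-- (ρ-multiplicative), and since r is a split epimorphism the monad laws of U and
-- the axioms on r descend from properties of m and τ.  The 2-cell extended in the last
-- axiom is τ ∘ T s (swap-τ), which also gives back λ as τ ∘ TS ηᵀ.
--
-- From a retraction, i and j are monad morphisms and r = μᵁ ∘ i j.  Splitting the
-- idempotent in the last two axioms gives S μᵀ ∘ s T = s ∘ μᵁ ∘ U j (σ-multʳ) and
-- μˢ T ∘ S (s ∘ μᵁ ∘ j U) ∘ s U = s ∘ μᵁ (σ-extension).  These two identities
-- turn both sides of each multiplication axiom for λ = s ∘ μᵁ ∘ j i into s after one and
-- the same multiplication in U.

open import Defs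
open import Level using (_⊔_)
open import Data.Product using (Σ-syntax; _×_; _,_)
open import Function.Bundles using (_↔_; _⇔_; mk⇔; mk↔ₛ′; Inverse; Equivalence)
open import Relation.Binary.Bundles using (Setoid)
open import Relation.Binary.PropositionalEquality as ≡ using (_≡_; cong; cong₂; subst)
open import Relation.Binary.HeterogeneousEquality as ≅ using (_≅_)
open import Relation.Binary.PropositionalEquality.WithK using (≡-irrelevant)
import Relation.Binary.Reasoning.Setoid as SetoidReasoning

-- The strict action of 1-cells on 1-cells

module Calculus {o ℓ e} (K : Strict2Category o ℓ e) (C : Strict2Category.Obj K) where
  open Strict2Category K

  private
    variable
      F F′ G G′ H H′ X Y : C ⇛ C

  infix 3 _≋_ _≈_ _↦_
  infixr 5 _∷_ _++_

  -- Equality of 2-cells with possibly different boundaries that, unlike _≅_, also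
  -- carries equality of the boundaries themselves.
  data _≋_ {F G : C ⇛ C} (α : F ⇒ G) : {F′ G′ : C ⇛ C} → F′ ⇒ G′ → Set (ℓ ⊔ e) where
    refl : α ≋ α

  ≋-sym : {α : F ⇒ G} {β : F′ ⇒ G′} → α ≋ β → β ≋ α
  ≋-sym refl = refl

  ≋-trans : {α : F ⇒ G} {β : F′ ⇒ G′} {γ : H ⇒ H′} → α ≋ β → β ≋ γ → α ≋ γ
  ≋-trans refl q = q

  ≡⇒≋ : {α β : F ⇒ G} → α ≡ β → α ≋ β
  ≡⇒≋ ≡.refl = refl

  ≋⇒≡ : {α β : F ⇒ G} → α ≋ β → α ≡ β
  ≋⇒≡ refl = ≡.refl

  ≋⇒≅ : {α : F ⇒ G} {β : F′ ⇒ G′} → α ≋ β → α ≅ β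
  ≋⇒≅ refl = ≅.refl

  ≅⇒≋ : {α : F ⇒ G} {β : F′ ⇒ G′} → F ≡ F′ → G ≡ G′ → α ≅ β → α ≋ β
  ≅⇒≋ ≡.refl ≡.refl ≅.refl = refl

  ≋-source : {α : F ⇒ G} {β : F′ ⇒ G′} → α ≋ β → F ≡ F′
  ≋-source refl = ≡.refl

  ≋-target : {α : F ⇒ G} {β : F′ ⇒ G′} → α ≋ β → G ≡ G′
  ≋-target refl = ≡.refl

  ∘-cong : {β : G ⇒ H} {β′ : G′ ⇒ H′} {α : F ⇒ G} {α′ : F′ ⇒ G′} →
           β ≋ β′ → α ≋ α′ → β ∘ α ≋ β′ ∘ α′
  ∘-cong refl refl = refl

  ◁-cong : {α : F ⇒ G} {α′ : F′ ⇒ G′} → α ≋ α′ → X ≡ Y → α ◁ X ≋ α′ ◁ Y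
  ◁-cong refl ≡.refl = refl

  ▷-cong : (S : C ⇛ C) {α : F ⇒ G} {α′ : F′ ⇒ G′} → α ≋ α′ → S ▷ α ≋ S ▷ α′
  ▷-cong S refl = refl

  -- Being a congruence, _≋_ turns the heterogeneous laws of the 2-category into
  -- rewriting rules without side conditions.
  ◁-id₁ : {α : F ⇒ G} → α ◁ id₁ ≋ α
  ◁-id₁ = ≅⇒≋ identityʳ identityʳ ⋆-identityʳ

  id₁-▷ : {α : F ⇒ G} → id₁ ▷ α ≋ α
  id₁-▷ = ≅⇒≋ identityˡ identityˡ ⋆-identityˡ

  ▷-◁ : (S : C ⇛ C) {α : F ⇒ G} → (S ▷ α) ◁ X ≋ S ▷ (α ◁ X)
  ▷-◁ S = ≅⇒≋ assoc assoc ⋆-assoc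

  ◁-◁ : {α : F ⇒ G} → (α ◁ H) ◁ X ≋ α ◁ (H · X)
  ◁-◁ {α = α} = ≋-trans (≅⇒≋ assoc assoc ⋆-assoc) (≡⇒≋ (cong (α ⋆_) ⋆-id₂))

  ·-▷ : (S T : C ⇛ C) {α : F ⇒ G} → (S · T) ▷ α ≋ S ▷ (T ▷ α)
  ·-▷ S T {α} = ≋-trans (≡⇒≋ (cong (_⋆ α) (≡.sym ⋆-id₂))) (≅⇒≋ assoc assoc ⋆-assoc)

  ◁-∘ : {β : G ⇒ H} {α : F ⇒ G} → (β ∘ α) ◁ X ≡ (β ◁ X) ∘ (α ◁ X)
  ◁-∘ {β = β} {α} = ≡.trans (cong ((β ∘ α) ⋆_) (≡.sym ∘-identityˡ)) interchange

  ▷-∘ : (S : C ⇛ C) {β : G ⇒ H} {α : F ⇒ G} → S ▷ (β ∘ α) ≡ (S ▷ β) ∘ (S ▷ α)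
  ▷-∘ S {β} {α} = ≡.trans (cong (_⋆ (β ∘ α)) (≡.sym ∘-identityˡ)) interchange

  ⋆-◁▷ : {β : G ⇒ G′} {α : F ⇒ F′} → β ⋆ α ≡ (β ◁ F′) ∘ (G ▷ α)
  ⋆-◁▷ = ≡.trans (cong₂ _⋆_ (≡.sym ∘-identityʳ) (≡.sym ∘-identityˡ)) interchange

  ⋆-▷◁ : {β : G ⇒ G′} {α : F ⇒ F′} → β ⋆ α ≡ (G′ ▷ α) ∘ (β ◁ F)
  ⋆-▷◁ = ≡.trans (cong₂ _⋆_ (≡.sym ∘-identityˡ) (≡.sym ∘-identityʳ)) interchange

  -- Formal vertical composites, outermost 2-cell first.  Concatenation and whiskering of
  -- concrete paths compute, so associativity and functoriality need no rewriting.
  data Path : C ⇛ C → C ⇛ C → Set (ℓ ⊔ e) where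
    []  : Path F F
    _∷_ : G ⇒ H → Path F G → Path F H

  eval : Path F G → F ⇒ G
  eval []      = id₂
  eval (α ∷ p) = α ∘ eval p

  _++_ : Path G H → Path F G → Path F H
  []      ++ q = q
  (α ∷ p) ++ q = α ∷ (p ++ q)

  _▷ₚ_ : (S : C ⇛ C) → Path F G → Path (S · F) (S · G)
  S ▷ₚ []      = []
  S ▷ₚ (α ∷ p) = S ▷ α ∷ (S ▷ₚ p)

  eval-++ : (p : Path G H) (q : Path F G) → eval (p ++ q) ≡ eval p ∘ eval q
  eval-++ []      q = ≡.sym ∘-identityˡ
  eval-++ (α ∷ p) q = ≡.trans (cong (α ∘_) (eval-++ p q)) (≡.sym ∘-assoc)

  eval-▷ₚ : (S : C ⇛ C) (p : Path F G) → eval (S ▷ₚ p) ≡ S ▷ eval p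
  eval-▷ₚ S []      = ≡.sym ⋆-id₂
  eval-▷ₚ S (α ∷ p) = ≡.trans (cong (S ▷ α ∘_) (eval-▷ₚ S p)) (≡.sym (▷-∘ S))

  -- Equality of composites, as a record so that the paths can be inferred from it.
  record _≈_ (p q : Path F G) : Set e where
    constructor equal
    field evaluate : eval p ≡ eval q
  open _≈_ public

  sym : {p q : Path F G} → p ≈ q → q ≈ p
  sym (equal h) = equal (≡.sym h)

  pathSetoid : C ⇛ C → C ⇛ C → Setoid (ℓ ⊔ e) e
  pathSetoid F G = record
    { Carrier       = Path F G
    ; _≈_           = _≈_
    ; isEquivalence = record
      { refl  = equal ≡.refl
      ; sym   = sym
      ; trans = λ (equal h) (equal k) → equal (≡.trans h k)
      }
    }

  module PathReasoning {F G : C ⇛ C} = SetoidReasoning (pathSetoid F G)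

  -- Rewriting in an initial segment, respectively after the first 2-cell.
  here : {p p′ : Path G H} {q : Path F G} → p ≈ p′ → p ++ q ≈ p′ ++ q
  here {p = p} {p′} {q} (equal h) = equal
    (≡.trans (eval-++ p q) (≡.trans (cong (_∘ eval q) h) (≡.sym (eval-++ p′ q))))

  there : {α : G ⇒ H} {p p′ : Path F G} → p ≈ p′ → α ∷ p ≈ α ∷ p′
  there {α = α} (equal h) = equal (cong (α ∘_) h)

  infixr 6 _▷≈_
  _▷≈_ : (S : C ⇛ C) {p p′ : Path F G} → p ≈ p′ → S ▷ₚ p ≈ S ▷ₚ p′
  _▷≈_ S {p} {p′} (equal h) = equal
    (≡.trans (eval-▷ₚ S p) (≡.trans (cong (S ▷_) h) (≡.sym (eval-▷ₚ S p′))))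

  -- A composite may be treated as a single 2-cell.
  collapse : (p : Path F G) → eval p ∷ [] ≈ p
  collapse p = equal ∘-identityʳ

  -- A 2-cell with a right inverse is an epimorphism.
  cancel : {α : F ⇒ G} {σ : G ⇒ F} {p q : Path G H} →
           α ∷ σ ∷ [] ≈ [] → p ++ α ∷ [] ≈ q ++ α ∷ [] → p ≈ q
  cancel {G = G} {H = H} {α} {σ} {p} {q} ασ h = begin
    p                   ≈⟨ insert p ⟩
    (p ++ α ∷ []) ++ σ ∷ [] ≈⟨ here h ⟩
    (q ++ α ∷ []) ++ σ ∷ [] ≈⟨ sym (insert q) ⟩
    q                   ∎
    where
    open PathReasoning
    insert : ∀ {J} (p : Path G J) → p ≈ (p ++ α ∷ []) ++ σ ∷ []
    insert []      = sym ασ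
    insert (β ∷ p) = there (insert p)

  -- α ↦ p: up to rebracketing, the whiskering of α with X is the composite of p X.  The
  -- source and target of p X are f X and g X, such as S · T · X for the source S · T.
  record _↦_ {F G : C ⇛ C} {f g : C ⇛ C → C ⇛ C}
             (α : F ⇒ G) (p : ∀ X → Path (f X) (g X)) : Set (ℓ ⊔ e) where
    constructor components
    field at : ∀ X → α ◁ X ≋ eval (p X)
  open _↦_ public

  private
    variable
      f g h : C ⇛ C → C ⇛ C

  ↦-cong : {α β : F ⇒ G} {p : ∀ X → Path (f X) (g X)} → α ≡ β → β ↦ p → α ↦ p
  ↦-cong ≡.refl a = a

  ↦-id : id₂ {F = F} ↦ (λ X → [] {F = F · X})
  ↦-id = components λ X → ≡⇒≋ ⋆-id₂

  ↦-∘ : {β : G ⇒ H} {α : F ⇒ G}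
        {q : ∀ X → Path (g X) (h X)} {p : ∀ X → Path (f X) (g X)} →
        β ↦ q → α ↦ p → (β ∘ α) ↦ λ X → q X ++ p X
  ↦-∘ {q = q} {p} b a = components λ X →
    ≋-trans (≡⇒≋ ◁-∘) (≋-trans (∘-cong (at b X) (at a X)) (≡⇒≋ (≡.sym (eval-++ (q X) (p X)))))

  ↦-∘⟨⟩ : {β : G′ ⇒ H} {α : F ⇒ G} (eq : G ≡ G′)
          {q : ∀ X → Path (g X) (h X)} {p : ∀ X → Path (f X) (g X)} →
          β ↦ q → α ↦ p → (β ∘⟨ eq ⟩ α) ↦ λ X → q X ++ p X
  ↦-∘⟨⟩ ≡.refl = ↦-∘

  ↦-subst : {α : F ⇒ G} (eq : F ≡ F′) {p : ∀ X → Path (f X) (g X)} →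
            α ↦ p → subst (_⇒ G) eq α ↦ p
  ↦-subst ≡.refl a = a

  ↦-▷ : {S : C ⇛ C} {α : F ⇒ G} {p : ∀ X → Path (f X) (g X)} →
        α ↦ p → (S ▷ α) ↦ λ X → S ▷ₚ p X
  ↦-▷ {S = S} {p = p} a = components λ X →
    ≋-trans (▷-◁ S) (≋-trans (▷-cong S (at a X)) (≡⇒≋ (≡.sym (eval-▷ₚ S (p X)))))

  ↦-◁-along : {α : F ⇒ G} {p : ∀ X → Path (f X) (g X)} →
              (∀ X → H · X ≡ h X) → α ↦ p → (α ◁ H) ↦ λ X → p (h X)
  ↦-◁-along eq a = components λ X →
    ≋-trans ◁-◁ (≋-trans (◁-cong refl (eq X)) (at a _))

  ↦-◁ : {α : F ⇒ G} {p : ∀ X → Path (f X) (g X)} →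
        α ↦ p → (α ◁ H) ↦ λ X → p (H · X)
  ↦-◁ = ↦-◁-along (λ _ → ≡.refl)

  -- The two decompositions of a horizontal composite.  Each requires one boundary of the
  -- left factor to act literally by composition: its source here, its target below.
  ↦-⋆ʳ : {β : G ⇒ G′} {α : F ⇒ F′}
         {q : ∀ X → Path (G · X) (h X)} {p : ∀ X → Path (f X) (g X)} →
         β ↦ q → α ↦ p → (β ⋆ α) ↦ λ X → q (g X) ++ (G ▷ₚ p X)
  ↦-⋆ʳ b a = ↦-cong ⋆-◁▷ (↦-∘ (↦-◁-along (λ X → ≋-target (at a X)) b) (↦-▷ a))

  ↦-⋆ˡ : {β : G ⇒ G′} {α : F ⇒ F′}
         {q : ∀ X → Path (h X) (G′ · X)} {p : ∀ X → Path (f X) (g X)} →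
         β ↦ q → α ↦ p → (β ⋆ α) ↦ λ X → (G′ ▷ₚ p X) ++ q (f X)
  ↦-⋆ˡ b a = ↦-cong ⋆-▷◁ (↦-∘ (↦-▷ a) (↦-◁-along (λ X → ≋-source (at a X)) b))

  -- A 2-cell is recovered from its component at the identity 1-cell.
  ↦-reflect : {α : F ⇒ G} {p : ∀ X → Path (f X) (g X)} → α ↦ p → α ≋ eval (p id₁)
  ↦-reflect a = ≋-trans (≋-sym ◁-id₁) (at a id₁)

  -- Faithfulness of the action.  No hypothesis on the boundaries is needed: the components
  -- at id₁ force those of α and β to agree.
  ≅⇔≈ : {α : F ⇒ G} {β : F′ ⇒ G′} {p q : ∀ X → Path (f X) (g X)} →
        α ↦ p → β ↦ q → (α ≅ β) ⇔ (∀ X → p X ≈ q X)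
  ≅⇔≈ a b = mk⇔
    (λ α≅β X → equal (≋⇒≡ (≋-trans (≋-sym (at a X)) (≋-trans
      (◁-cong (≅⇒≋ (≡.trans (≋-source (↦-reflect a)) (≡.sym (≋-source (↦-reflect b))))
                   (≡.trans (≋-target (↦-reflect a)) (≡.sym (≋-target (↦-reflect b))))
                   α≅β) ≡.refl)
      (at b X)))))
    (λ p≈q → ≋⇒≅ (≋-trans (↦-reflect a)
      (≋-trans (≡⇒≋ (evaluate (p≈q id₁))) (≋-sym (↦-reflect b)))))

  ≅⇒≈ : {α : F ⇒ G} {β : F′ ⇒ G′} {p q : ∀ X → Path (f X) (g X)} →
        α ↦ p → β ↦ q → α ≅ β → ∀ X → p X ≈ q X
  ≅⇒≈ a b = Equivalence.to (≅⇔≈ a b)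

  ≈⇒≅ : {α : F ⇒ G} {β : F′ ⇒ G′} {p q : ∀ X → Path (f X) (g X)} →
        α ↦ p → β ↦ q → (∀ X → p X ≈ q X) → α ≅ β
  ≈⇒≅ a b = Equivalence.from (≅⇔≈ a b)

  cast : F ≡ F′ → G ≡ G′ → F ⇒ G → F′ ⇒ G′
  cast ≡.refl ≡.refl α = α

  cast-≋ : (p : F ≡ F′) (q : G ≡ G′) (α : F ⇒ G) → α ≋ cast p q α
  cast-≋ ≡.refl ≡.refl α = refl

  -- Components of a 2-cell with m-fold source and n-fold target, rebracketed to the right.
  at₀₁ : id₁ {C} ⇒ F → (X : C ⇛ C) → X ⇒ F · X
  at₀₁ α X = cast identityˡ ≡.refl (α ◁ X)

  at₁₁ : F ⇒ G → (X : C ⇛ C) → F · X ⇒ G · X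
  at₁₁ α X = α ◁ X

  at₂₁ : F · G ⇒ H → (X : C ⇛ C) → F · G · X ⇒ H · X
  at₂₁ α X = cast assoc ≡.refl (α ◁ X)

  at₁₂ : H ⇒ F · G → (X : C ⇛ C) → H · X ⇒ F · G · X
  at₁₂ α X = cast ≡.refl assoc (α ◁ X)

  at₂₂ : F · G ⇒ F′ · G′ → (X : C ⇛ C) → F · G · X ⇒ F′ · G′ · X
  at₂₂ α X = cast assoc assoc (α ◁ X)

  private
    single : {α : F ⇒ G} {β : F′ ⇒ G′} → α ≋ β → α ≋ eval (β ∷ [])
    single a = ≋-trans a (≡⇒≋ (≡.sym ∘-identityʳ))

  ↦₀₁ : (α : id₁ {C} ⇒ F) → α ↦ λ X → at₀₁ α X ∷ []
  ↦₀₁ α = components λ X → single (cast-≋ _ _ (α ◁ X))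

  ↦₁₁ : (α : F ⇒ G) → α ↦ λ X → at₁₁ α X ∷ []
  ↦₁₁ α = components λ X → single (refl {α = α ◁ X})

  ↦₂₁ : (α : F · G ⇒ H) → α ↦ λ X → at₂₁ α X ∷ []
  ↦₂₁ α = components λ X → single (cast-≋ _ _ (α ◁ X))

  ↦₁₂ : (α : H ⇒ F · G) → α ↦ λ X → at₁₂ α X ∷ []
  ↦₁₂ α = components λ X → single (cast-≋ _ _ (α ◁ X))

  ↦₂₂ : (α : F · G ⇒ F′ · G′) → α ↦ λ X → at₂₂ α X ∷ []
  ↦₂₂ α = components λ X → single (cast-≋ _ _ (α ◁ X))

  private
    -- Both sides are the horizontal composite of α and ξ.
    natural : {α : F ⇒ G} {a : ∀ X → f X ⇒ g X} → α ↦ (λ X → a X ∷ []) →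
              {ξ : X ⇒ Y} {fξ : f X ⇒ f Y} {gξ : g X ⇒ g Y} →
              F ▷ ξ ≋ fξ → G ▷ ξ ≋ gξ → gξ ∷ a X ∷ [] ≈ a Y ∷ fξ ∷ []
    natural {X = X} {Y = Y} {α = α} {a} α↦a eF eG = equal (≋⇒≡ (≋-trans
      (≋-sym (∘-cong eG (at α↦a X)))
      (≋-trans (≡⇒≋ (≡.trans (≡.sym ⋆-▷◁) ⋆-◁▷))
        (∘-cong (≋-trans (at α↦a Y) (≡⇒≋ ∘-identityʳ)) (single eF)))))

  nat₀₁ : (α : id₁ {C} ⇒ F) (ξ : X ⇒ Y) → F ▷ ξ ∷ at₀₁ α X ∷ [] ≈ at₀₁ α Y ∷ ξ ∷ []
  nat₀₁ α ξ = natural (↦₀₁ α) id₁-▷ refl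

  nat₁₁ : (α : F ⇒ G) (ξ : X ⇒ Y) → G ▷ ξ ∷ at₁₁ α X ∷ [] ≈ at₁₁ α Y ∷ F ▷ ξ ∷ []
  nat₁₁ α ξ = natural (↦₁₁ α) refl refl

  nat₂₁ : (α : F · G ⇒ H) (ξ : X ⇒ Y) →
          H ▷ ξ ∷ at₂₁ α X ∷ [] ≈ at₂₁ α Y ∷ F ▷ G ▷ ξ ∷ []
  nat₂₁ {F = F} {G} α ξ = natural (↦₂₁ α) (·-▷ F G) refl

  nat₁₂ : (α : H ⇒ F · G) (ξ : X ⇒ Y) →
          F ▷ G ▷ ξ ∷ at₁₂ α X ∷ [] ≈ at₁₂ α Y ∷ H ▷ ξ ∷ []
  nat₁₂ {F = F} {G} α ξ = natural (↦₁₂ α) refl (·-▷ F G)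

  nat₂₂ : (α : F · G ⇒ F′ · G′) (ξ : X ⇒ Y) →
          F′ ▷ G′ ▷ ξ ∷ at₂₂ α X ∷ [] ≈ at₂₂ α Y ∷ F ▷ G ▷ ξ ∷ []
  nat₂₂ {F = F} {G} {F′} {G′} α ξ = natural (↦₂₂ α) (·-▷ F G) (·-▷ F′ G′)

-- The axioms in components

-- Components η X, μ X of the unit and multiplication of a monad, and the translation of the
-- monad laws.
module MonadComponents {o ℓ e} {K : Strict2Category o ℓ e} {C : Strict2Category.Obj K}
                       (M : RawMonad K C) where
  open Strict2Category K
  open Calculus K C
  private
    T = RawMonad.cell M
    variable X Y : C ⇛ C

  η : (X : C ⇛ C) → X ⇒ T · X
  η = at₀₁ (RawMonad.η M)

  μ : (X : C ⇛ C) → T · T · X ⇒ T · X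
  μ = at₂₁ (RawMonad.μ M)

  ↦η : RawMonad.η M ↦ λ X → η X ∷ []
  ↦η = ↦₀₁ (RawMonad.η M)

  ↦μ : RawMonad.μ M ↦ λ X → μ X ∷ []
  ↦μ = ↦₂₁ (RawMonad.μ M)

  η-natural : (ξ : X ⇒ Y) → T ▷ ξ ∷ η X ∷ [] ≈ η Y ∷ ξ ∷ []
  η-natural = nat₀₁ (RawMonad.η M)

  μ-natural : (ξ : X ⇒ Y) → T ▷ ξ ∷ μ X ∷ [] ≈ μ Y ∷ T ▷ T ▷ ξ ∷ []
  μ-natural = nat₂₁ (RawMonad.μ M)

  unitʳ⇔ : (RawMonad.μ M ∘ (T ▷ RawMonad.η M) ≅ id₂ {F = T}) ⇔
           (∀ X → μ X ∷ T ▷ η X ∷ [] ≈ [])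
  unitʳ⇔ = ≅⇔≈ (↦-∘ ↦μ (↦-▷ ↦η)) ↦-id

  unitˡ⇔ : (RawMonad.μ M ∘ (RawMonad.η M ◁ T) ≅ id₂ {F = T}) ⇔
           (∀ X → μ X ∷ η (T · X) ∷ [] ≈ [])
  unitˡ⇔ = ≅⇔≈ (↦-∘ ↦μ (↦-◁ ↦η)) ↦-id

  assoc⇔ : (RawMonad.μ M ∘ (T ▷ RawMonad.μ M) ≅ RawMonad.μ M ∘ (RawMonad.μ M ◁ T)) ⇔
           (∀ X → μ X ∷ T ▷ μ X ∷ [] ≈ μ X ∷ μ (T · X) ∷ [])
  assoc⇔ = ≅⇔≈ (↦-∘ ↦μ (↦-▷ ↦μ)) (↦-∘ ↦μ (↦-◁ ↦μ))

-- The laws of a monad, in components.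
module MonadLaws {o ℓ e} {K : Strict2Category o ℓ e} {C : Strict2Category.Obj K}
                 (M : Monad K C) where
  open Strict2Category K
  open Calculus K C
  open MonadComponents (Monad.raw M) public
  open IsMonad (Monad.isMonad M) renaming (unitʳ to unitʳ-≅; unitˡ to unitˡ-≅)
  private
    T = Monad.cell M

  unitʳ : ∀ X → μ X ∷ T ▷ η X ∷ [] ≈ []
  unitʳ = Equivalence.to unitʳ⇔ unitʳ-≅

  unitˡ : ∀ X → μ X ∷ η (T · X) ∷ [] ≈ []
  unitˡ = Equivalence.to unitˡ⇔ unitˡ-≅

  associative : ∀ X → μ X ∷ T ▷ μ X ∷ [] ≈ μ X ∷ μ (T · X) ∷ []
  associative = Equivalence.to assoc⇔ assocᴹ

module _ {o ℓ e} {K : Strict2Category o ℓ e} {C : Strict2Category.Obj K} where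
  open Strict2Category K
  open Calculus K C
  open Monad using () renaming (cell to ⟨_⟩)

  -- Components ρ, σ, ι, κ of 2-cells r, s and of the induced i, j, and the translation of
  -- the axioms of a distributing retraction.  Only the underlying data of U enter, so that
  -- the translation is available before U is known to be a monad.
  module RetractionComponents (𝐒 𝐓 : Monad K C) (𝐔 : RawMonad K C)
      (r : ⟨ 𝐒 ⟩ · ⟨ 𝐓 ⟩ ⇒ RawMonad.cell 𝐔) (s : RawMonad.cell 𝐔 ⇒ ⟨ 𝐒 ⟩ · ⟨ 𝐓 ⟩) where
    private
      S = ⟨ 𝐒 ⟩
      T = ⟨ 𝐓 ⟩
      U = RawMonad.cell 𝐔
      variable X Y : C ⇛ C
      module S = MonadComponents (Monad.raw 𝐒)
      module T = MonadComponents (Monad.raw 𝐓)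
      module U = MonadComponents 𝐔
      i = inclusionˡ 𝐒 𝐓 r
      j = inclusionʳ 𝐒 𝐓 r

    ρ : (X : C ⇛ C) → S · T · X ⇒ U · X
    ρ = at₂₁ r

    σ : (X : C ⇛ C) → U · X ⇒ S · T · X
    σ = at₁₂ s

    ι : (X : C ⇛ C) → S · X ⇒ U · X
    ι = at₁₁ i

    κ : (X : C ⇛ C) → T · X ⇒ U · X
    κ = at₁₁ j

    ρ-natural : (ξ : X ⇒ Y) → U ▷ ξ ∷ ρ X ∷ [] ≈ ρ Y ∷ S ▷ T ▷ ξ ∷ []
    ρ-natural = nat₂₁ r

    σ-natural : (ξ : X ⇒ Y) → S ▷ T ▷ ξ ∷ σ X ∷ [] ≈ σ Y ∷ U ▷ ξ ∷ []
    σ-natural = nat₁₂ s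

    ι-natural : (ξ : X ⇒ Y) → U ▷ ξ ∷ ι X ∷ [] ≈ ι Y ∷ S ▷ ξ ∷ []
    ι-natural = nat₁₁ i

    κ-natural : (ξ : X ⇒ Y) → U ▷ ξ ∷ κ X ∷ [] ≈ κ Y ∷ T ▷ ξ ∷ []
    κ-natural = nat₁₁ j

    ι-def : ∀ X → ι X ∷ [] ≈ ρ X ∷ S ▷ T.η X ∷ []
    ι-def = ≅⇒≈ (↦₁₁ i) (↦-subst identityʳ (↦-∘ (↦₂₁ r) (↦-▷ T.↦η))) ≅.refl

    κ-def : ∀ X → κ X ∷ [] ≈ ρ X ∷ S.η (T · X) ∷ []
    κ-def = ≅⇒≈ (↦₁₁ j) (↦-subst identityˡ (↦-∘ (↦₂₁ r) (↦-◁ S.↦η))) ≅.refl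

    retraction⇔ : (r ∘ s ≅ id₂) ⇔ (∀ X → ρ X ∷ σ X ∷ [] ≈ [])
    retraction⇔ = ≅⇔≈ (↦-∘ (↦₂₁ r) (↦₁₂ s)) ↦-id

    r-unit⇔ : (r ∘ (Monad.η 𝐒 ⋆ Monad.η 𝐓) ≅ RawMonad.η 𝐔) ⇔
              (∀ X → ρ X ∷ S ▷ T.η X ∷ S.η X ∷ [] ≈ U.η X ∷ [])
    r-unit⇔ = ≅⇔≈ (↦-∘ (↦₂₁ r) (↦-⋆ˡ S.↦η T.↦η)) U.↦η

    r-multˡ⇔ : (r ∘ (Monad.μ 𝐒 ◁ T) ≅ RawMonad.μ 𝐔 ∘ (i ⋆ r)) ⇔
               (∀ X → ρ X ∷ S.μ (T · X) ∷ [] ≈ U.μ X ∷ ι (U · X) ∷ S ▷ ρ X ∷ [])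
    r-multˡ⇔ = ≅⇔≈ (↦-∘ (↦₂₁ r) (↦-◁ S.↦μ))
                   (↦-∘ U.↦μ (↦-⋆ʳ (↦₁₁ i) (↦₂₁ r)))

    r-multʳ⇔ : (r ∘ (S ▷ Monad.μ 𝐓) ≅ RawMonad.μ 𝐔 ∘ (r ⋆ j)) ⇔
               (∀ X → ρ X ∷ S ▷ T.μ X ∷ [] ≈ U.μ X ∷ U ▷ κ X ∷ ρ (T · X) ∷ [])
    r-multʳ⇔ = ≅⇔≈ (↦-∘ (↦₂₁ r) (↦-▷ T.↦μ)) (↦-∘ U.↦μ (↦-⋆ˡ (↦₂₁ r) (↦₁₁ j)))

    ↦idem : (s ∘ r) ↦ λ X → σ X ∷ ρ X ∷ []
    ↦idem = ↦-∘ (↦₁₂ s) (↦₂₁ r)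

    ↦inducedLaw : (s ∘ RawMonad.μ 𝐔 ∘ (j ⋆ i)) ↦ λ X → σ X ∷ U.μ X ∷ κ (U · X) ∷ T ▷ ι X ∷ []
    ↦inducedLaw = ↦-∘ (↦₁₂ s) (↦-∘ U.↦μ (↦-⋆ʳ (↦₁₁ j) (↦₁₁ i)))

    private
      ↦extension : extension 𝐒 (s ∘ RawMonad.μ 𝐔 ∘ (j ◁ U)) ↦
                   λ X → S.μ (T · X) ∷ S ▷ σ X ∷ S ▷ U.μ X ∷ S ▷ κ (U · X) ∷ []
      ↦extension = ↦-∘⟨⟩ (≡.sym assoc) (↦-◁ S.↦μ)
        (↦-▷ (↦-∘ (↦₁₂ s) (↦-∘ U.↦μ (↦-◁ (↦₁₁ j)))))

    idem-unit⇔ : ((s ∘ r) ∘ (Monad.η 𝐒 ◁ T) ≅ Monad.η 𝐒 ◁ T) ⇔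
                 (∀ X → σ X ∷ ρ X ∷ S.η (T · X) ∷ [] ≈ S.η (T · X) ∷ [])
    idem-unit⇔ = ≅⇔≈ (↦-∘ ↦idem (↦-◁ S.↦η)) (↦-◁ S.↦η)

    idem-mult⇔ : ((s ∘ r) ∘ (S ▷ Monad.μ 𝐓) ≅ (S ▷ Monad.μ 𝐓) ∘⟨ assoc ⟩ ((s ∘ r) ◁ T)) ⇔
                 (∀ X → σ X ∷ ρ X ∷ S ▷ T.μ X ∷ [] ≈ S ▷ T.μ X ∷ σ (T · X) ∷ ρ (T · X) ∷ [])
    idem-mult⇔ = ≅⇔≈ (↦-∘ ↦idem (↦-▷ T.↦μ))
                     (↦-∘⟨⟩ assoc (↦-▷ T.↦μ) (↦-◁ ↦idem))

    idem-extends⇔ :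
      ((s ∘ r) ∘ extension 𝐒 (s ∘ RawMonad.μ 𝐔 ∘ (j ◁ U)) ≅
       extension 𝐒 (s ∘ RawMonad.μ 𝐔 ∘ (j ◁ U)) ∘⟨ assoc ⟩ ((s ∘ r) ◁ U)) ⇔
      (∀ X → σ X ∷ ρ X ∷ S.μ (T · X) ∷ S ▷ σ X ∷ S ▷ U.μ X ∷ S ▷ κ (U · X) ∷ [] ≈
             S.μ (T · X) ∷ S ▷ σ X ∷ S ▷ U.μ X ∷ S ▷ κ (U · X) ∷ σ (U · X) ∷ ρ (U · X) ∷ [])
    idem-extends⇔ = ≅⇔≈ (↦-∘ ↦idem ↦extension)
                        (↦-∘⟨⟩ assoc ↦extension (↦-◁ ↦idem))

  -- Components δ of a 2-cell T · S ⇒ S · T, and the translation of the axioms of a weak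
  -- distributive law.
  module LawComponents (𝐒 𝐓 : Monad K C) (law : ⟨ 𝐓 ⟩ · ⟨ 𝐒 ⟩ ⇒ ⟨ 𝐒 ⟩ · ⟨ 𝐓 ⟩) where
    private
      S = ⟨ 𝐒 ⟩
      T = ⟨ 𝐓 ⟩
      variable X Y : C ⇛ C
      module S = MonadComponents (Monad.raw 𝐒)
      module T = MonadComponents (Monad.raw 𝐓)

    δ : (X : C ⇛ C) → T · S · X ⇒ S · T · X
    δ = at₂₂ law

    ↦δ : law ↦ λ X → δ X ∷ []
    ↦δ = ↦₂₂ law

    δ-natural : (ξ : X ⇒ Y) → S ▷ T ▷ ξ ∷ δ X ∷ [] ≈ δ Y ∷ T ▷ S ▷ ξ ∷ []
    δ-natural = nat₂₂ law

    ↦lawIdempotent : lawIdempotent 𝐒 𝐓 law ↦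
                     λ X → S ▷ T.μ X ∷ δ (T · X) ∷ T.η (S · T · X) ∷ []
    ↦lawIdempotent = ↦-subst identityˡ
      (↦-∘⟨⟩ assoc (↦-▷ T.↦μ) (↦-∘⟨⟩ (≡.sym assoc) (↦-◁ ↦δ) (↦-◁-along (λ _ → assoc) T.↦η)))

    law-unit⇔ : (law ∘ (T ▷ Monad.η 𝐒) ≅ Monad.η 𝐒 ◁ T) ⇔
                (∀ X → δ X ∷ T ▷ S.η X ∷ [] ≈ S.η (T · X) ∷ [])
    law-unit⇔ = ≅⇔≈ (↦-∘ ↦δ (↦-▷ S.↦η)) (↦-◁ S.↦η)

    law-multˡ⇔ :
      (law ∘ (T ▷ Monad.μ 𝐒) ≅
       (Monad.μ 𝐒 ◁ T) ∘⟨ ≡.sym assoc ⟩ (S ▷ law) ∘⟨ assoc ⟩ (law ◁ S)) ⇔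
      (∀ X → δ X ∷ T ▷ S.μ X ∷ [] ≈ S.μ (T · X) ∷ S ▷ δ X ∷ δ (S · X) ∷ [])
    law-multˡ⇔ = ≅⇔≈ (↦-∘ ↦δ (↦-▷ S.↦μ))
      (↦-∘⟨⟩ (≡.sym assoc) (↦-◁ S.↦μ) (↦-∘⟨⟩ assoc (↦-▷ ↦δ) (↦-◁ ↦δ)))

    law-multʳ⇔ :
      (law ∘ (Monad.μ 𝐓 ◁ S) ≅
       (S ▷ Monad.μ 𝐓) ∘⟨ assoc ⟩ (law ◁ T) ∘⟨ ≡.sym assoc ⟩ (T ▷ law)) ⇔
      (∀ X → δ X ∷ T.μ (S · X) ∷ [] ≈ S ▷ T.μ X ∷ δ (T · X) ∷ T ▷ δ X ∷ [])
    law-multʳ⇔ = ≅⇔≈ (↦-∘ ↦δ (↦-◁ T.↦μ))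
      (↦-∘⟨⟩ assoc (↦-▷ T.↦μ) (↦-∘⟨⟩ (≡.sym assoc) (↦-◁ ↦δ) (↦-▷ ↦δ)))

-- From weak distributive laws to distributing retractions

module FromLaw {o ℓ e} {K : Strict2Category o ℓ e} {C : Strict2Category.Obj K}
               (y : SplitWeakDistributiveLaw K C) where
  open Strict2Category K
  open Calculus K C
  open PathReasoning
  open SplitWeakDistributiveLaw y renaming (S to 𝐒; T to 𝐓)
  private
    module W = IsWeakDistributiveLaw isWeakDistributiveLaw
    module Sp = IsSplitting isSplitting
    S = Monad.cell 𝐒
    T = Monad.cell 𝐓
    module S = MonadLaws 𝐒
    module T = MonadLaws 𝐓

  -- The unit and multiplication on U, not yet known to satisfy the monad laws.
  𝐔ʳ : RawMonad K C
  𝐔ʳ = RetractionData.U (toRetractionData y)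

  private
    module U = MonadComponents 𝐔ʳ
  open S using () renaming (η to ηˢ; μ to μˢ)
  open T using () renaming (η to ηᵗ; μ to μᵗ)
  open U using () renaming (η to ηᵘ; μ to μᵘ)
  open RetractionComponents 𝐒 𝐓 𝐔ʳ r s
  open LawComponents 𝐒 𝐓 law

  δ-unit : ∀ X → δ X ∷ T ▷ ηˢ X ∷ [] ≈ ηˢ (T · X) ∷ []
  δ-unit = Equivalence.to law-unit⇔ W.law-unit

  δ-multˡ : ∀ X → δ X ∷ T ▷ μˢ X ∷ [] ≈ μˢ (T · X) ∷ S ▷ δ X ∷ δ (S · X) ∷ []
  δ-multˡ = Equivalence.to law-multˡ⇔ W.law-multˡ

  δ-multʳ : ∀ X → δ X ∷ μᵗ (S · X) ∷ [] ≈ S ▷ μᵗ X ∷ δ (T · X) ∷ T ▷ δ X ∷ []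
  δ-multʳ = Equivalence.to law-multʳ⇔ W.law-multʳ

  ρσ : ∀ X → ρ X ∷ σ X ∷ [] ≈ []
  ρσ = Equivalence.to retraction⇔ (≅.≡-to-≅ Sp.retraction)

  ↦inducedUnit : RawMonad.η 𝐔ʳ ↦ λ X → ρ X ∷ S ▷ ηᵗ X ∷ ηˢ X ∷ []
  ↦inducedUnit = ↦-subst identityˡ (↦-∘ (↦₂₁ r) (↦-⋆ˡ S.↦η T.↦η))

  ↦inducedMult : RawMonad.μ 𝐔ʳ ↦ λ X →
    ρ X ∷ S ▷ μᵗ X ∷ μˢ (T · T · X) ∷ S ▷ δ (T · X) ∷ σ (S · T · X) ∷ U ▷ σ X ∷ []
  ↦inducedMult =
    ↦-∘ (↦₂₁ r) (↦-∘⟨⟩ (≡.trans (cong (S ·_) assoc) (≡.sym assoc)) (↦-⋆ˡ S.↦μ T.↦μ)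
      (↦-∘⟨⟩ (≡.trans assoc (cong (S ·_) (≡.sym assoc))) (↦-▷ (↦-◁ ↦δ)) (↦-⋆ʳ (↦₁₂ s) (↦₁₂ s))))

  ηᵘ-def : ∀ X → ηᵘ X ∷ [] ≈ ρ X ∷ S ▷ ηᵗ X ∷ ηˢ X ∷ []
  ηᵘ-def = ≅⇒≈ U.↦η ↦inducedUnit ≅.refl

  -- The action of T on S · T, as a single 2-cell.
  τ : (X : C ⇛ C) → T · S · T · X ⇒ S · T · X
  τ X = eval (S ▷ μᵗ X ∷ δ (T · X) ∷ [])

  τ-def : ∀ X → τ X ∷ [] ≈ S ▷ μᵗ X ∷ δ (T · X) ∷ []
  τ-def X = collapse _

  σρ-def : ∀ X → σ X ∷ ρ X ∷ [] ≈ τ X ∷ ηᵗ (S · T · X) ∷ []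
  σρ-def X = begin
    σ X ∷ ρ X ∷ []
      ≈⟨ ≅⇒≈ ↦idem ↦lawIdempotent (≅.≡-to-≅ Sp.splits) X ⟩
    S ▷ μᵗ X ∷ δ (T · X) ∷ ηᵗ (S · T · X) ∷ []
      ≈⟨ here (sym (τ-def X)) ⟩
    τ X ∷ ηᵗ (S · T · X) ∷ [] ∎

  τ-action : ∀ X → τ X ∷ T ▷ τ X ∷ [] ≈ τ X ∷ μᵗ (S · T · X) ∷ []
  τ-action X = begin
    τ X ∷ T ▷ τ X ∷ []
      ≈⟨ there (T ▷≈ τ-def X) ⟩
    τ X ∷ T ▷ S ▷ μᵗ X ∷ T ▷ δ (T · X) ∷ []
      ≈⟨ here (τ-def X) ⟩
    S ▷ μᵗ X ∷ δ (T · X) ∷ T ▷ S ▷ μᵗ X ∷ T ▷ δ (T · X) ∷ []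
      ≈⟨ there (here (sym (δ-natural _))) ⟩
    S ▷ μᵗ X ∷ S ▷ T ▷ μᵗ X ∷ δ (T · T · X) ∷ T ▷ δ (T · X) ∷ []
      ≈⟨ here (S ▷≈ T.associative X) ⟩
    S ▷ μᵗ X ∷ S ▷ μᵗ (T · X) ∷ δ (T · T · X) ∷ T ▷ δ (T · X) ∷ []
      ≈⟨ there (sym (δ-multʳ (T · X))) ⟩
    S ▷ μᵗ X ∷ δ (T · X) ∷ μᵗ (S · T · X) ∷ []
      ≈⟨ here (sym (τ-def X)) ⟩
    τ X ∷ μᵗ (S · T · X) ∷ [] ∎

  τ-μˢ : ∀ X → τ X ∷ T ▷ μˢ (T · X) ∷ [] ≈ μˢ (T · X) ∷ S ▷ τ X ∷ δ (S · T · X) ∷ []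
  τ-μˢ X = begin
    τ X ∷ T ▷ μˢ (T · X) ∷ []
      ≈⟨ here (τ-def X) ⟩
    S ▷ μᵗ X ∷ δ (T · X) ∷ T ▷ μˢ (T · X) ∷ []
      ≈⟨ there (δ-multˡ (T · X)) ⟩
    S ▷ μᵗ X ∷ μˢ (T · T · X) ∷ S ▷ δ (T · X) ∷ δ (S · T · X) ∷ []
      ≈⟨ here (S.μ-natural _) ⟩
    μˢ (T · X) ∷ S ▷ S ▷ μᵗ X ∷ S ▷ δ (T · X) ∷ δ (S · T · X) ∷ []
      ≈⟨ there (here (S ▷≈ sym (τ-def X))) ⟩
    μˢ (T · X) ∷ S ▷ τ X ∷ δ (S · T · X) ∷ [] ∎

  τ-ηˢ : ∀ X → τ X ∷ T ▷ ηˢ (T · X) ∷ [] ≈ ηˢ (T · X) ∷ μᵗ X ∷ []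
  τ-ηˢ X = begin
    τ X ∷ T ▷ ηˢ (T · X) ∷ []              ≈⟨ here (τ-def X) ⟩
    S ▷ μᵗ X ∷ δ (T · X) ∷ T ▷ ηˢ (T · X) ∷ [] ≈⟨ there (δ-unit (T · X)) ⟩
    S ▷ μᵗ X ∷ ηˢ (T · T · X) ∷ []         ≈⟨ S.η-natural _ ⟩
    ηˢ (T · X) ∷ μᵗ X ∷ []                 ∎

  τ-μᵗ : ∀ X → τ X ∷ T ▷ S ▷ μᵗ X ∷ [] ≈ S ▷ μᵗ X ∷ τ (T · X) ∷ []
  τ-μᵗ X = begin
    τ X ∷ T ▷ S ▷ μᵗ X ∷ []                      ≈⟨ here (τ-def X) ⟩
    S ▷ μᵗ X ∷ δ (T · X) ∷ T ▷ S ▷ μᵗ X ∷ []     ≈⟨ there (sym (δ-natural _)) ⟩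
    S ▷ μᵗ X ∷ S ▷ T ▷ μᵗ X ∷ δ (T · T · X) ∷ [] ≈⟨ here (S ▷≈ T.associative X) ⟩
    S ▷ μᵗ X ∷ S ▷ μᵗ (T · X) ∷ δ (T · T · X) ∷ [] ≈⟨ there (sym (τ-def (T · X))) ⟩
    S ▷ μᵗ X ∷ τ (T · X) ∷ []                    ∎

  τ-ηᵗ : ∀ X → τ X ∷ T ▷ S ▷ ηᵗ X ∷ [] ≈ δ X ∷ []
  τ-ηᵗ X = begin
    τ X ∷ T ▷ S ▷ ηᵗ X ∷ []                  ≈⟨ here (τ-def X) ⟩
    S ▷ μᵗ X ∷ δ (T · X) ∷ T ▷ S ▷ ηᵗ X ∷ [] ≈⟨ there (sym (δ-natural _)) ⟩
    S ▷ μᵗ X ∷ S ▷ T ▷ ηᵗ X ∷ δ X ∷ []       ≈⟨ here (S ▷≈ T.unitʳ X) ⟩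
    δ X ∷ []                                 ∎

  τ-σρ : ∀ X → τ X ∷ T ▷ σ X ∷ T ▷ ρ X ∷ [] ≈ τ X ∷ []
  τ-σρ X = begin
    τ X ∷ T ▷ σ X ∷ T ▷ ρ X ∷ []               ≈⟨ there (T ▷≈ σρ-def X) ⟩
    τ X ∷ T ▷ τ X ∷ T ▷ ηᵗ (S · T · X) ∷ []    ≈⟨ here (τ-action X) ⟩
    τ X ∷ μᵗ (S · T · X) ∷ T ▷ ηᵗ (S · T · X) ∷ [] ≈⟨ there (T.unitʳ (S · T · X)) ⟩
    τ X ∷ []                                   ∎

  σρ-fixes-τ : ∀ X → σ X ∷ ρ X ∷ τ X ∷ [] ≈ τ X ∷ []
  σρ-fixes-τ X = begin
    σ X ∷ ρ X ∷ τ X ∷ []                           ≈⟨ here (σρ-def X) ⟩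
    τ X ∷ ηᵗ (S · T · X) ∷ τ X ∷ []                ≈⟨ there (sym (T.η-natural _)) ⟩
    τ X ∷ T ▷ τ X ∷ ηᵗ (T · S · T · X) ∷ []        ≈⟨ here (τ-action X) ⟩
    τ X ∷ μᵗ (S · T · X) ∷ ηᵗ (T · S · T · X) ∷ [] ≈⟨ there (T.unitˡ (S · T · X)) ⟩
    τ X ∷ []                                       ∎

  -- With m = μˢ T ∘ S τ, this is e ∘ μˢ T = m ∘ (λ ∘ ηᵀ S) ST.
  σρ-μˢ : ∀ X → σ X ∷ ρ X ∷ μˢ (T · X) ∷ [] ≈
                μˢ (T · X) ∷ S ▷ τ X ∷ δ (S · T · X) ∷ ηᵗ (S · S · T · X) ∷ []
  σρ-μˢ X = begin
    σ X ∷ ρ X ∷ μˢ (T · X) ∷ []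
      ≈⟨ here (σρ-def X) ⟩
    τ X ∷ ηᵗ (S · T · X) ∷ μˢ (T · X) ∷ []
      ≈⟨ there (sym (T.η-natural _)) ⟩
    τ X ∷ T ▷ μˢ (T · X) ∷ ηᵗ (S · S · T · X) ∷ []
      ≈⟨ here (τ-μˢ X) ⟩
    μˢ (T · X) ∷ S ▷ τ X ∷ δ (S · T · X) ∷ ηᵗ (S · S · T · X) ∷ [] ∎

  -- The idempotent passes through m in its first argument; τ-σρ says that m absorbs it in
  -- the second.
  m-absorbs : ∀ X → σ X ∷ ρ X ∷ μˢ (T · X) ∷ S ▷ τ X ∷ [] ≈
                    μˢ (T · X) ∷ S ▷ τ X ∷ σ (S · T · X) ∷ ρ (S · T · X) ∷ []
  m-absorbs X = begin
    σ X ∷ ρ X ∷ μˢ (T · X) ∷ S ▷ τ X ∷ []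
      ≈⟨ here (σρ-μˢ X) ⟩
    μˢ (T · X) ∷ S ▷ τ X ∷ δ (S · T · X) ∷ ηᵗ (S · S · T · X) ∷ S ▷ τ X ∷ []
      ≈⟨ there (there (there (sym (T.η-natural _)))) ⟩
    μˢ (T · X) ∷ S ▷ τ X ∷ δ (S · T · X) ∷ T ▷ S ▷ τ X ∷ ηᵗ (S · T · S · T · X) ∷ []
      ≈⟨ there (there (here (sym (δ-natural _)))) ⟩
    μˢ (T · X) ∷ S ▷ τ X ∷ S ▷ T ▷ τ X ∷ δ (T · S · T · X) ∷ ηᵗ (S · T · S · T · X) ∷ []
      ≈⟨ there (here (S ▷≈ τ-action X)) ⟩
    μˢ (T · X) ∷ S ▷ τ X ∷ S ▷ μᵗ (S · T · X) ∷ δ (T · S · T · X) ∷ ηᵗ (S · T · S · T · X) ∷ []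
      ≈⟨ there (there (here (sym (τ-def (S · T · X))))) ⟩
    μˢ (T · X) ∷ S ▷ τ X ∷ τ (S · T · X) ∷ ηᵗ (S · T · S · T · X) ∷ []
      ≈⟨ there (there (sym (σρ-def (S · T · X)))) ⟩
    μˢ (T · X) ∷ S ▷ τ X ∷ σ (S · T · X) ∷ ρ (S · T · X) ∷ [] ∎

  m-associative : ∀ X →
    μˢ (T · X) ∷ S ▷ τ X ∷ S ▷ T ▷ μˢ (T · X) ∷ S ▷ T ▷ S ▷ τ X ∷ [] ≈
    μˢ (T · X) ∷ S ▷ τ X ∷ μˢ (T · S · T · X) ∷ S ▷ τ (S · T · X) ∷ []
  m-associative X = begin
    μˢ (T · X) ∷ S ▷ τ X ∷ S ▷ T ▷ μˢ (T · X) ∷ S ▷ T ▷ S ▷ τ X ∷ []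
      ≈⟨ there (here (S ▷≈ τ-μˢ X)) ⟩
    μˢ (T · X) ∷ S ▷ μˢ (T · X) ∷ S ▷ S ▷ τ X ∷ S ▷ δ (S · T · X) ∷ S ▷ T ▷ S ▷ τ X ∷ []
      ≈⟨ there (there (there (S ▷≈ sym (δ-natural _)))) ⟩
    μˢ (T · X) ∷ S ▷ μˢ (T · X) ∷ S ▷ S ▷ τ X ∷ S ▷ S ▷ T ▷ τ X ∷ S ▷ δ (T · S · T · X) ∷ []
      ≈⟨ there (there (here (S ▷≈ S ▷≈ τ-action X))) ⟩
    μˢ (T · X) ∷ S ▷ μˢ (T · X) ∷ S ▷ S ▷ τ X ∷ S ▷ S ▷ μᵗ (S · T · X) ∷
      S ▷ δ (T · S · T · X) ∷ []
      ≈⟨ there (there (there (S ▷≈ sym (τ-def (S · T · X))))) ⟩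
    μˢ (T · X) ∷ S ▷ μˢ (T · X) ∷ S ▷ S ▷ τ X ∷ S ▷ τ (S · T · X) ∷ []
      ≈⟨ here (S.associative (T · X)) ⟩
    μˢ (T · X) ∷ μˢ (S · T · X) ∷ S ▷ S ▷ τ X ∷ S ▷ τ (S · T · X) ∷ []
      ≈⟨ there (here (sym (S.μ-natural _))) ⟩
    μˢ (T · X) ∷ S ▷ τ X ∷ μˢ (T · S · T · X) ∷ S ▷ τ (S · T · X) ∷ [] ∎

  μᵘ-def : ∀ X → μᵘ X ∷ [] ≈
                 ρ X ∷ μˢ (T · X) ∷ S ▷ τ X ∷ σ (S · T · X) ∷ U ▷ σ X ∷ []
  μᵘ-def X = begin
    μᵘ X ∷ []
      ≈⟨ ≅⇒≈ U.↦μ ↦inducedMult ≅.refl X ⟩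
    ρ X ∷ S ▷ μᵗ X ∷ μˢ (T · T · X) ∷ S ▷ δ (T · X) ∷ σ (S · T · X) ∷ U ▷ σ X ∷ []
      ≈⟨ there (here (S.μ-natural _)) ⟩
    ρ X ∷ μˢ (T · X) ∷ S ▷ S ▷ μᵗ X ∷ S ▷ δ (T · X) ∷ σ (S · T · X) ∷ U ▷ σ X ∷ []
      ≈⟨ there (there (here (S ▷≈ sym (τ-def X)))) ⟩
    ρ X ∷ μˢ (T · X) ∷ S ▷ τ X ∷ σ (S · T · X) ∷ U ▷ σ X ∷ [] ∎

  -- Both idempotents created by expanding μᵘ disappear: the first through m-absorbs and
  -- ρ ∘ σ = id, the second through τ-σρ.
  ρ-multiplicative : ∀ X → μᵘ X ∷ U ▷ ρ X ∷ ρ (S · T · X) ∷ [] ≈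
                           ρ X ∷ μˢ (T · X) ∷ S ▷ τ X ∷ []
  ρ-multiplicative X = begin
    μᵘ X ∷ U ▷ ρ X ∷ ρ (S · T · X) ∷ []
      ≈⟨ here (μᵘ-def X) ⟩
    ρ X ∷ μˢ (T · X) ∷ S ▷ τ X ∷ σ (S · T · X) ∷ U ▷ σ X ∷ U ▷ ρ X ∷ ρ (S · T · X) ∷ []
      ≈⟨ there (there (there (there (there (ρ-natural _))))) ⟩
    ρ X ∷ μˢ (T · X) ∷ S ▷ τ X ∷ σ (S · T · X) ∷ U ▷ σ X ∷ ρ (U · X) ∷ S ▷ T ▷ ρ X ∷ []
      ≈⟨ there (there (there (there (here (ρ-natural _))))) ⟩
    ρ X ∷ μˢ (T · X) ∷ S ▷ τ X ∷ σ (S · T · X) ∷ ρ (S · T · X) ∷ S ▷ T ▷ σ X ∷ S ▷ T ▷ ρ X ∷ []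
      ≈⟨ there (here (sym (m-absorbs X))) ⟩
    ρ X ∷ σ X ∷ ρ X ∷ μˢ (T · X) ∷ S ▷ τ X ∷ S ▷ T ▷ σ X ∷ S ▷ T ▷ ρ X ∷ []
      ≈⟨ here (ρσ X) ⟩
    ρ X ∷ μˢ (T · X) ∷ S ▷ τ X ∷ S ▷ T ▷ σ X ∷ S ▷ T ▷ ρ X ∷ []
      ≈⟨ there (there (S ▷≈ τ-σρ X)) ⟩
    ρ X ∷ μˢ (T · X) ∷ S ▷ τ X ∷ [] ∎

  -- The monad laws of U hold after precomposing with the epimorphism ρ, where
  -- ρ-multiplicative reduces them to properties of m.
  μᵘ-unitʳ : ∀ X → μᵘ X ∷ U ▷ ηᵘ X ∷ [] ≈ []
  μᵘ-unitʳ X = cancel (ρσ X) (begin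
    μᵘ X ∷ U ▷ ηᵘ X ∷ ρ X ∷ []
      ≈⟨ there (ρ-natural _) ⟩
    μᵘ X ∷ ρ (U · X) ∷ S ▷ T ▷ ηᵘ X ∷ []
      ≈⟨ there (there (S ▷≈ T ▷≈ ηᵘ-def X)) ⟩
    μᵘ X ∷ ρ (U · X) ∷ S ▷ T ▷ ρ X ∷ S ▷ T ▷ S ▷ ηᵗ X ∷ S ▷ T ▷ ηˢ X ∷ []
      ≈⟨ there (here (sym (ρ-natural _))) ⟩
    μᵘ X ∷ U ▷ ρ X ∷ ρ (S · T · X) ∷ S ▷ T ▷ S ▷ ηᵗ X ∷ S ▷ T ▷ ηˢ X ∷ []
      ≈⟨ here (ρ-multiplicative X) ⟩
    ρ X ∷ μˢ (T · X) ∷ S ▷ τ X ∷ S ▷ T ▷ S ▷ ηᵗ X ∷ S ▷ T ▷ ηˢ X ∷ []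
      ≈⟨ there (there (here (S ▷≈ τ-ηᵗ X))) ⟩
    ρ X ∷ μˢ (T · X) ∷ S ▷ δ X ∷ S ▷ T ▷ ηˢ X ∷ []
      ≈⟨ there (there (S ▷≈ δ-unit X)) ⟩
    ρ X ∷ μˢ (T · X) ∷ S ▷ ηˢ (T · X) ∷ []
      ≈⟨ there (S.unitʳ (T · X)) ⟩
    ρ X ∷ [] ∎)

  μᵘ-unitˡ : ∀ X → μᵘ X ∷ ηᵘ (U · X) ∷ [] ≈ []
  μᵘ-unitˡ X = cancel (ρσ X) (begin
    μᵘ X ∷ ηᵘ (U · X) ∷ ρ X ∷ []
      ≈⟨ there (sym (U.η-natural _)) ⟩
    μᵘ X ∷ U ▷ ρ X ∷ ηᵘ (S · T · X) ∷ []
      ≈⟨ there (there (ηᵘ-def (S · T · X))) ⟩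
    μᵘ X ∷ U ▷ ρ X ∷ ρ (S · T · X) ∷ S ▷ ηᵗ (S · T · X) ∷ ηˢ (S · T · X) ∷ []
      ≈⟨ here (ρ-multiplicative X) ⟩
    ρ X ∷ μˢ (T · X) ∷ S ▷ τ X ∷ S ▷ ηᵗ (S · T · X) ∷ ηˢ (S · T · X) ∷ []
      ≈⟨ there (there (here (S ▷≈ sym (σρ-def X)))) ⟩
    ρ X ∷ μˢ (T · X) ∷ S ▷ σ X ∷ S ▷ ρ X ∷ ηˢ (S · T · X) ∷ []
      ≈⟨ there (there (there (S.η-natural _))) ⟩
    ρ X ∷ μˢ (T · X) ∷ S ▷ σ X ∷ ηˢ (U · X) ∷ ρ X ∷ []
      ≈⟨ there (there (here (S.η-natural _))) ⟩
    ρ X ∷ μˢ (T · X) ∷ ηˢ (S · T · X) ∷ σ X ∷ ρ X ∷ []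
      ≈⟨ there (here (S.unitˡ (T · X))) ⟩
    ρ X ∷ σ X ∷ ρ X ∷ []
      ≈⟨ here (ρσ X) ⟩
    ρ X ∷ [] ∎)

  μᵘ-associative : ∀ X → μᵘ X ∷ U ▷ μᵘ X ∷ [] ≈ μᵘ X ∷ μᵘ (U · X) ∷ []
  μᵘ-associative X =
    cancel (U ▷≈ U ▷≈ ρσ X) (cancel (U ▷≈ ρσ (S · T · X)) (cancel (ρσ (S · T · S · T · X)) (begin
      μᵘ X ∷ U ▷ μᵘ X ∷ U ▷ U ▷ ρ X ∷ U ▷ ρ (S · T · X) ∷ ρ (S · T · S · T · X) ∷ []
        ≈⟨ there (here (U ▷≈ ρ-multiplicative X)) ⟩
      μᵘ X ∷ U ▷ ρ X ∷ U ▷ μˢ (T · X) ∷ U ▷ S ▷ τ X ∷ ρ (S · T · S · T · X) ∷ []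
        ≈⟨ there (there (there (ρ-natural _))) ⟩
      μᵘ X ∷ U ▷ ρ X ∷ U ▷ μˢ (T · X) ∷ ρ (S · S · T · X) ∷ S ▷ T ▷ S ▷ τ X ∷ []
        ≈⟨ there (there (here (ρ-natural _))) ⟩
      μᵘ X ∷ U ▷ ρ X ∷ ρ (S · T · X) ∷ S ▷ T ▷ μˢ (T · X) ∷ S ▷ T ▷ S ▷ τ X ∷ []
        ≈⟨ here (ρ-multiplicative X) ⟩
      ρ X ∷ μˢ (T · X) ∷ S ▷ τ X ∷ S ▷ T ▷ μˢ (T · X) ∷ S ▷ T ▷ S ▷ τ X ∷ []
        ≈⟨ there (m-associative X) ⟩
      ρ X ∷ μˢ (T · X) ∷ S ▷ τ X ∷ μˢ (T · S · T · X) ∷ S ▷ τ (S · T · X) ∷ []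
        ≈⟨ here (sym (ρ-multiplicative X)) ⟩
      μᵘ X ∷ U ▷ ρ X ∷ ρ (S · T · X) ∷ μˢ (T · S · T · X) ∷ S ▷ τ (S · T · X) ∷ []
        ≈⟨ there (there (sym (ρ-multiplicative (S · T · X)))) ⟩
      μᵘ X ∷ U ▷ ρ X ∷ μᵘ (S · T · X) ∷ U ▷ ρ (S · T · X) ∷ ρ (S · T · S · T · X) ∷ []
        ≈⟨ there (here (U.μ-natural _)) ⟩
      μᵘ X ∷ μᵘ (U · X) ∷ U ▷ U ▷ ρ X ∷ U ▷ ρ (S · T · X) ∷ ρ (S · T · S · T · X) ∷ [] ∎)))

  𝐔 : Monad K C
  𝐔 = record
    { raw     = 𝐔ʳ
    ; isMonad = record
      { unitʳ  = Equivalence.from U.unitʳ⇔ μᵘ-unitʳ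
      ; unitˡ  = Equivalence.from U.unitˡ⇔ μᵘ-unitˡ
      ; assocᴹ = Equivalence.from U.assoc⇔ μᵘ-associative
      }
    }

  -- The right-hand side reduces to r ∘ μˢ T ∘ S e.  Here S e can be dropped because
  -- r = r ∘ e and e ∘ μˢ T ∘ S e = e ∘ μˢ T, which holds by σρ-μˢ and τ-σρ.
  ρ-multˡ : ∀ X → ρ X ∷ μˢ (T · X) ∷ [] ≈ μᵘ X ∷ ι (U · X) ∷ S ▷ ρ X ∷ []
  ρ-multˡ X = sym (begin
    μᵘ X ∷ ι (U · X) ∷ S ▷ ρ X ∷ []
      ≈⟨ there (here (ι-def (U · X))) ⟩
    μᵘ X ∷ ρ (U · X) ∷ S ▷ ηᵗ (U · X) ∷ S ▷ ρ X ∷ []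
      ≈⟨ there (there (S ▷≈ sym (T.η-natural _))) ⟩
    μᵘ X ∷ ρ (U · X) ∷ S ▷ T ▷ ρ X ∷ S ▷ ηᵗ (S · T · X) ∷ []
      ≈⟨ there (here (sym (ρ-natural _))) ⟩
    μᵘ X ∷ U ▷ ρ X ∷ ρ (S · T · X) ∷ S ▷ ηᵗ (S · T · X) ∷ []
      ≈⟨ here (ρ-multiplicative X) ⟩
    ρ X ∷ μˢ (T · X) ∷ S ▷ τ X ∷ S ▷ ηᵗ (S · T · X) ∷ []
      ≈⟨ there (there (S ▷≈ sym (σρ-def X))) ⟩
    ρ X ∷ μˢ (T · X) ∷ S ▷ σ X ∷ S ▷ ρ X ∷ []
      ≈⟨ sym (here (ρσ X)) ⟩
    ρ X ∷ σ X ∷ ρ X ∷ μˢ (T · X) ∷ S ▷ σ X ∷ S ▷ ρ X ∷ []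
      ≈⟨ there (here (σρ-μˢ X)) ⟩
    ρ X ∷ μˢ (T · X) ∷ S ▷ τ X ∷ δ (S · T · X) ∷ ηᵗ (S · S · T · X) ∷ S ▷ σ X ∷ S ▷ ρ X ∷ []
      ≈⟨ there (there (there (there (here (sym (T.η-natural _)))))) ⟩
    ρ X ∷ μˢ (T · X) ∷ S ▷ τ X ∷ δ (S · T · X) ∷ T ▷ S ▷ σ X ∷ ηᵗ (S · U · X) ∷ S ▷ ρ X ∷ []
      ≈⟨ there (there (there (there (there (sym (T.η-natural _)))))) ⟩
    ρ X ∷ μˢ (T · X) ∷ S ▷ τ X ∷ δ (S · T · X) ∷ T ▷ S ▷ σ X ∷ T ▷ S ▷ ρ X ∷
      ηᵗ (S · S · T · X) ∷ []
      ≈⟨ there (there (there (here (sym (δ-natural _))))) ⟩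
    ρ X ∷ μˢ (T · X) ∷ S ▷ τ X ∷ S ▷ T ▷ σ X ∷ δ (U · X) ∷ T ▷ S ▷ ρ X ∷
      ηᵗ (S · S · T · X) ∷ []
      ≈⟨ there (there (there (there (here (sym (δ-natural _)))))) ⟩
    ρ X ∷ μˢ (T · X) ∷ S ▷ τ X ∷ S ▷ T ▷ σ X ∷ S ▷ T ▷ ρ X ∷ δ (S · T · X) ∷
      ηᵗ (S · S · T · X) ∷ []
      ≈⟨ there (there (here (S ▷≈ τ-σρ X))) ⟩
    ρ X ∷ μˢ (T · X) ∷ S ▷ τ X ∷ δ (S · T · X) ∷ ηᵗ (S · S · T · X) ∷ []
      ≈⟨ there (sym (σρ-μˢ X)) ⟩
    ρ X ∷ σ X ∷ ρ X ∷ μˢ (T · X) ∷ []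
      ≈⟨ here (ρσ X) ⟩
    ρ X ∷ μˢ (T · X) ∷ [] ∎)

  ρ-multʳ : ∀ X → ρ X ∷ S ▷ μᵗ X ∷ [] ≈ μᵘ X ∷ U ▷ κ X ∷ ρ (T · X) ∷ []
  ρ-multʳ X = sym (begin
    μᵘ X ∷ U ▷ κ X ∷ ρ (T · X) ∷ []
      ≈⟨ there (here (U ▷≈ κ-def X)) ⟩
    μᵘ X ∷ U ▷ ρ X ∷ U ▷ ηˢ (T · X) ∷ ρ (T · X) ∷ []
      ≈⟨ there (there (ρ-natural _)) ⟩
    μᵘ X ∷ U ▷ ρ X ∷ ρ (S · T · X) ∷ S ▷ T ▷ ηˢ (T · X) ∷ []
      ≈⟨ here (ρ-multiplicative X) ⟩
    ρ X ∷ μˢ (T · X) ∷ S ▷ τ X ∷ S ▷ T ▷ ηˢ (T · X) ∷ []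
      ≈⟨ there (there (S ▷≈ τ-ηˢ X)) ⟩
    ρ X ∷ μˢ (T · X) ∷ S ▷ ηˢ (T · X) ∷ S ▷ μᵗ X ∷ []
      ≈⟨ there (here (S.unitʳ (T · X))) ⟩
    ρ X ∷ S ▷ μᵗ X ∷ [] ∎)

  σρ-unit : ∀ X → σ X ∷ ρ X ∷ ηˢ (T · X) ∷ [] ≈ ηˢ (T · X) ∷ []
  σρ-unit X = begin
    σ X ∷ ρ X ∷ ηˢ (T · X) ∷ []               ≈⟨ here (σρ-def X) ⟩
    τ X ∷ ηᵗ (S · T · X) ∷ ηˢ (T · X) ∷ []    ≈⟨ there (sym (T.η-natural _)) ⟩
    τ X ∷ T ▷ ηˢ (T · X) ∷ ηᵗ (T · X) ∷ []    ≈⟨ here (τ-ηˢ X) ⟩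
    ηˢ (T · X) ∷ μᵗ X ∷ ηᵗ (T · X) ∷ []       ≈⟨ there (T.unitˡ X) ⟩
    ηˢ (T · X) ∷ []                           ∎

  σρ-mult : ∀ X → σ X ∷ ρ X ∷ S ▷ μᵗ X ∷ [] ≈ S ▷ μᵗ X ∷ σ (T · X) ∷ ρ (T · X) ∷ []
  σρ-mult X = begin
    σ X ∷ ρ X ∷ S ▷ μᵗ X ∷ []
      ≈⟨ here (σρ-def X) ⟩
    τ X ∷ ηᵗ (S · T · X) ∷ S ▷ μᵗ X ∷ []
      ≈⟨ there (sym (T.η-natural _)) ⟩
    τ X ∷ T ▷ S ▷ μᵗ X ∷ ηᵗ (S · T · T · X) ∷ []
      ≈⟨ here (τ-μᵗ X) ⟩
    S ▷ μᵗ X ∷ τ (T · X) ∷ ηᵗ (S · T · T · X) ∷ []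
      ≈⟨ there (sym (σρ-def (T · X))) ⟩
    S ▷ μᵗ X ∷ σ (T · X) ∷ ρ (T · X) ∷ [] ∎

  -- The 2-cell whose extension occurs in the last axiom is τ ∘ T s; both sides agree after
  -- precomposing with the epimorphism T r.
  swap-τ : ∀ X → σ X ∷ μᵘ X ∷ κ (U · X) ∷ [] ≈ τ X ∷ T ▷ σ X ∷ []
  swap-τ X = cancel (T ▷≈ ρσ X) (begin
    σ X ∷ μᵘ X ∷ κ (U · X) ∷ T ▷ ρ X ∷ []
      ≈⟨ there (there (sym (κ-natural _))) ⟩
    σ X ∷ μᵘ X ∷ U ▷ ρ X ∷ κ (S · T · X) ∷ []
      ≈⟨ there (there (there (κ-def (S · T · X)))) ⟩
    σ X ∷ μᵘ X ∷ U ▷ ρ X ∷ ρ (S · T · X) ∷ ηˢ (T · S · T · X) ∷ []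
      ≈⟨ there (here (ρ-multiplicative X)) ⟩
    σ X ∷ ρ X ∷ μˢ (T · X) ∷ S ▷ τ X ∷ ηˢ (T · S · T · X) ∷ []
      ≈⟨ there (there (there (S.η-natural _))) ⟩
    σ X ∷ ρ X ∷ μˢ (T · X) ∷ ηˢ (S · T · X) ∷ τ X ∷ []
      ≈⟨ there (there (here (S.unitˡ (T · X)))) ⟩
    σ X ∷ ρ X ∷ τ X ∷ []
      ≈⟨ σρ-fixes-τ X ⟩
    τ X ∷ []
      ≈⟨ sym (τ-σρ X) ⟩
    τ X ∷ T ▷ σ X ∷ T ▷ ρ X ∷ [] ∎)

  σρ-extends : ∀ X →
    σ X ∷ ρ X ∷ μˢ (T · X) ∷ S ▷ σ X ∷ S ▷ μᵘ X ∷ S ▷ κ (U · X) ∷ [] ≈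
    μˢ (T · X) ∷ S ▷ σ X ∷ S ▷ μᵘ X ∷ S ▷ κ (U · X) ∷ σ (U · X) ∷ ρ (U · X) ∷ []
  σρ-extends X = begin
    σ X ∷ ρ X ∷ μˢ (T · X) ∷ S ▷ σ X ∷ S ▷ μᵘ X ∷ S ▷ κ (U · X) ∷ []
      ≈⟨ there (there (there (S ▷≈ swap-τ X))) ⟩
    σ X ∷ ρ X ∷ μˢ (T · X) ∷ S ▷ τ X ∷ S ▷ T ▷ σ X ∷ []
      ≈⟨ here (m-absorbs X) ⟩
    μˢ (T · X) ∷ S ▷ τ X ∷ σ (S · T · X) ∷ ρ (S · T · X) ∷ S ▷ T ▷ σ X ∷ []
      ≈⟨ there (there (there (sym (ρ-natural _)))) ⟩
    μˢ (T · X) ∷ S ▷ τ X ∷ σ (S · T · X) ∷ U ▷ σ X ∷ ρ (U · X) ∷ []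
      ≈⟨ there (there (here (sym (σ-natural _)))) ⟩
    μˢ (T · X) ∷ S ▷ τ X ∷ S ▷ T ▷ σ X ∷ σ (U · X) ∷ ρ (U · X) ∷ []
      ≈⟨ there (here (S ▷≈ sym (swap-τ X))) ⟩
    μˢ (T · X) ∷ S ▷ σ X ∷ S ▷ μᵘ X ∷ S ▷ κ (U · X) ∷ σ (U · X) ∷ ρ (U · X) ∷ [] ∎

  recovers-δ : ∀ X → σ X ∷ μᵘ X ∷ κ (U · X) ∷ T ▷ ι X ∷ [] ≈ δ X ∷ []
  recovers-δ X = begin
    σ X ∷ μᵘ X ∷ κ (U · X) ∷ T ▷ ι X ∷ []       ≈⟨ here (swap-τ X) ⟩
    τ X ∷ T ▷ σ X ∷ T ▷ ι X ∷ []                ≈⟨ there (there (T ▷≈ ι-def X)) ⟩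
    τ X ∷ T ▷ σ X ∷ T ▷ ρ X ∷ T ▷ S ▷ ηᵗ X ∷ [] ≈⟨ here (τ-σρ X) ⟩
    τ X ∷ T ▷ S ▷ ηᵗ X ∷ []                     ≈⟨ τ-ηᵗ X ⟩
    δ X ∷ []                                    ∎

  retraction : DistributingRetraction K C
  retraction = record
    { S = 𝐒
    ; T = 𝐓
    ; U = 𝐔
    ; r = r
    ; s = s
    ; isDistributingRetraction = record
      { retraction   = Sp.retraction
      ; r-unit       = Equivalence.from r-unit⇔ λ X → sym (ηᵘ-def X)
      ; r-multˡ      = Equivalence.from r-multˡ⇔ ρ-multˡ
      ; r-multʳ      = Equivalence.from r-multʳ⇔ ρ-multʳ
      ; idem-unit    = ≅.≅-to-≡ (Equivalence.from idem-unit⇔ σρ-unit)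
      ; idem-mult    = Equivalence.from idem-mult⇔ σρ-mult
      ; idem-extends = Equivalence.from idem-extends⇔ σρ-extends
      }
    }

  law-recovered : SplitLawData.law (toSplitLawData retraction) ≡ law
  law-recovered = ≅.≅-to-≡ (≈⇒≅ ↦inducedLaw ↦δ recovers-δ)

-- From distributing retractions to weak distributive laws

module FromRetraction {o ℓ e} {K : Strict2Category o ℓ e} {C : Strict2Category.Obj K}
                      (x : DistributingRetraction K C) where
  open Strict2Category K
  open Calculus K C
  open PathReasoning
  open DistributingRetraction x renaming (S to 𝐒; T to 𝐓; U to 𝐔)
  private
    module D = IsDistributingRetraction isDistributingRetraction
    S = Monad.cell 𝐒
    T = Monad.cell 𝐓
    U = Monad.cell 𝐔
    module S = MonadLaws 𝐒
    module T = MonadLaws 𝐓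
    module U = MonadLaws 𝐔
  open S using () renaming (η to ηˢ; μ to μˢ)
  open T using () renaming (η to ηᵗ; μ to μᵗ)
  open U using () renaming (η to ηᵘ; μ to μᵘ)
  open RetractionComponents 𝐒 𝐓 (Monad.raw 𝐔) r s

  ρσ : ∀ X → ρ X ∷ σ X ∷ [] ≈ []
  ρσ = Equivalence.to retraction⇔ (≅.≡-to-≅ D.retraction)

  ρ-unit : ∀ X → ρ X ∷ S ▷ ηᵗ X ∷ ηˢ X ∷ [] ≈ ηᵘ X ∷ []
  ρ-unit = Equivalence.to r-unit⇔ D.r-unit

  ρ-multˡ : ∀ X → ρ X ∷ μˢ (T · X) ∷ [] ≈ μᵘ X ∷ ι (U · X) ∷ S ▷ ρ X ∷ []
  ρ-multˡ = Equivalence.to r-multˡ⇔ D.r-multˡ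

  ρ-multʳ : ∀ X → ρ X ∷ S ▷ μᵗ X ∷ [] ≈ μᵘ X ∷ U ▷ κ X ∷ ρ (T · X) ∷ []
  ρ-multʳ = Equivalence.to r-multʳ⇔ D.r-multʳ

  σρ-unit : ∀ X → σ X ∷ ρ X ∷ ηˢ (T · X) ∷ [] ≈ ηˢ (T · X) ∷ []
  σρ-unit = Equivalence.to idem-unit⇔ (≅.≡-to-≅ D.idem-unit)

  σρ-mult : ∀ X → σ X ∷ ρ X ∷ S ▷ μᵗ X ∷ [] ≈ S ▷ μᵗ X ∷ σ (T · X) ∷ ρ (T · X) ∷ []
  σρ-mult = Equivalence.to idem-mult⇔ D.idem-mult

  σρ-extends : ∀ X →
    σ X ∷ ρ X ∷ μˢ (T · X) ∷ S ▷ σ X ∷ S ▷ μᵘ X ∷ S ▷ κ (U · X) ∷ [] ≈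
    μˢ (T · X) ∷ S ▷ σ X ∷ S ▷ μᵘ X ∷ S ▷ κ (U · X) ∷ σ (U · X) ∷ ρ (U · X) ∷ []
  σρ-extends = Equivalence.to idem-extends⇔ D.idem-extends

  -- Restricting ρ-multˡ along the unit of S gives r = μᵁ ∘ i j.
  ρ-factors : ∀ X → ρ X ∷ [] ≈ μᵘ X ∷ ι (U · X) ∷ S ▷ κ X ∷ []
  ρ-factors X = begin
    ρ X ∷ []
      ≈⟨ there (sym (S.unitʳ (T · X))) ⟩
    ρ X ∷ μˢ (T · X) ∷ S ▷ ηˢ (T · X) ∷ []
      ≈⟨ here (ρ-multˡ X) ⟩
    μᵘ X ∷ ι (U · X) ∷ S ▷ ρ X ∷ S ▷ ηˢ (T · X) ∷ []
      ≈⟨ there (there (S ▷≈ sym (κ-def X))) ⟩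
    μᵘ X ∷ ι (U · X) ∷ S ▷ κ X ∷ [] ∎

  -- By the next four lemmas, i and j are monad morphisms.
  ι-unit : ∀ X → ι X ∷ ηˢ X ∷ [] ≈ ηᵘ X ∷ []
  ι-unit X = begin
    ι X ∷ ηˢ X ∷ []            ≈⟨ here (ι-def X) ⟩
    ρ X ∷ S ▷ ηᵗ X ∷ ηˢ X ∷ [] ≈⟨ ρ-unit X ⟩
    ηᵘ X ∷ []                  ∎

  κ-unit : ∀ X → κ X ∷ ηᵗ X ∷ [] ≈ ηᵘ X ∷ []
  κ-unit X = begin
    κ X ∷ ηᵗ X ∷ []             ≈⟨ here (κ-def X) ⟩
    ρ X ∷ ηˢ (T · X) ∷ ηᵗ X ∷ [] ≈⟨ there (sym (S.η-natural _)) ⟩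
    ρ X ∷ S ▷ ηᵗ X ∷ ηˢ X ∷ []  ≈⟨ ρ-unit X ⟩
    ηᵘ X ∷ []                   ∎

  ι-mult : ∀ X → ι X ∷ μˢ X ∷ [] ≈ μᵘ X ∷ ι (U · X) ∷ S ▷ ι X ∷ []
  ι-mult X = begin
    ι X ∷ μˢ X ∷ []
      ≈⟨ here (ι-def X) ⟩
    ρ X ∷ S ▷ ηᵗ X ∷ μˢ X ∷ []
      ≈⟨ there (S.μ-natural _) ⟩
    ρ X ∷ μˢ (T · X) ∷ S ▷ S ▷ ηᵗ X ∷ []
      ≈⟨ here (ρ-multˡ X) ⟩
    μᵘ X ∷ ι (U · X) ∷ S ▷ ρ X ∷ S ▷ S ▷ ηᵗ X ∷ []
      ≈⟨ there (there (S ▷≈ sym (ι-def X))) ⟩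
    μᵘ X ∷ ι (U · X) ∷ S ▷ ι X ∷ [] ∎

  κ-mult : ∀ X → κ X ∷ μᵗ X ∷ [] ≈ μᵘ X ∷ U ▷ κ X ∷ κ (T · X) ∷ []
  κ-mult X = begin
    κ X ∷ μᵗ X ∷ []
      ≈⟨ here (κ-def X) ⟩
    ρ X ∷ ηˢ (T · X) ∷ μᵗ X ∷ []
      ≈⟨ there (sym (S.η-natural _)) ⟩
    ρ X ∷ S ▷ μᵗ X ∷ ηˢ (T · T · X) ∷ []
      ≈⟨ here (ρ-multʳ X) ⟩
    μᵘ X ∷ U ▷ κ X ∷ ρ (T · X) ∷ ηˢ (T · T · X) ∷ []
      ≈⟨ there (there (sym (κ-def (T · X)))) ⟩
    μᵘ X ∷ U ▷ κ X ∷ κ (T · X) ∷ [] ∎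

  σκ : ∀ X → σ X ∷ κ X ∷ [] ≈ ηˢ (T · X) ∷ []
  σκ X = begin
    σ X ∷ κ X ∷ []                  ≈⟨ there (κ-def X) ⟩
    σ X ∷ ρ X ∷ ηˢ (T · X) ∷ []     ≈⟨ σρ-unit X ⟩
    ηˢ (T · X) ∷ []                 ∎

  -- The section s commutes with right multiplication by T: idempotence is traded for this
  -- by inserting ρ ∘ σ = id under σρ-mult.
  σ-multʳ : ∀ X → S ▷ μᵗ X ∷ σ (T · X) ∷ [] ≈ σ X ∷ μᵘ X ∷ U ▷ κ X ∷ []
  σ-multʳ X = begin
    S ▷ μᵗ X ∷ σ (T · X) ∷ []
      ≈⟨ there (there (sym (ρσ (T · X)))) ⟩
    S ▷ μᵗ X ∷ σ (T · X) ∷ ρ (T · X) ∷ σ (T · X) ∷ []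
      ≈⟨ here (sym (σρ-mult X)) ⟩
    σ X ∷ ρ X ∷ S ▷ μᵗ X ∷ σ (T · X) ∷ []
      ≈⟨ there (here (ρ-multʳ X)) ⟩
    σ X ∷ μᵘ X ∷ U ▷ κ X ∷ ρ (T · X) ∷ σ (T · X) ∷ []
      ≈⟨ there (there (there (ρσ (T · X)))) ⟩
    σ X ∷ μᵘ X ∷ U ▷ κ X ∷ [] ∎

  ρ-extension : ∀ X →
    ρ X ∷ μˢ (T · X) ∷ S ▷ σ X ∷ S ▷ μᵘ X ∷ S ▷ κ (U · X) ∷ [] ≈ μᵘ X ∷ ρ (U · X) ∷ []
  ρ-extension X = begin
    ρ X ∷ μˢ (T · X) ∷ S ▷ σ X ∷ S ▷ μᵘ X ∷ S ▷ κ (U · X) ∷ []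
      ≈⟨ here (ρ-multˡ X) ⟩
    μᵘ X ∷ ι (U · X) ∷ S ▷ ρ X ∷ S ▷ σ X ∷ S ▷ μᵘ X ∷ S ▷ κ (U · X) ∷ []
      ≈⟨ there (there (here (S ▷≈ ρσ X))) ⟩
    μᵘ X ∷ ι (U · X) ∷ S ▷ μᵘ X ∷ S ▷ κ (U · X) ∷ []
      ≈⟨ there (here (sym (ι-natural _))) ⟩
    μᵘ X ∷ U ▷ μᵘ X ∷ ι (U · U · X) ∷ S ▷ κ (U · X) ∷ []
      ≈⟨ here (U.associative X) ⟩
    μᵘ X ∷ μᵘ (U · X) ∷ ι (U · U · X) ∷ S ▷ κ (U · X) ∷ []
      ≈⟨ there (sym (ρ-factors (U · X))) ⟩
    μᵘ X ∷ ρ (U · X) ∷ [] ∎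

  -- The analogue for the last axiom, obtained by inserting ρ ∘ σ = id under σρ-extends.
  σ-extension : ∀ X →
    μˢ (T · X) ∷ S ▷ σ X ∷ S ▷ μᵘ X ∷ S ▷ κ (U · X) ∷ σ (U · X) ∷ [] ≈ σ X ∷ μᵘ X ∷ []
  σ-extension X = begin
    μˢ (T · X) ∷ S ▷ σ X ∷ S ▷ μᵘ X ∷ S ▷ κ (U · X) ∷ σ (U · X) ∷ []
      ≈⟨ there (there (there (there (there (sym (ρσ (U · X))))))) ⟩
    μˢ (T · X) ∷ S ▷ σ X ∷ S ▷ μᵘ X ∷ S ▷ κ (U · X) ∷ σ (U · X) ∷ ρ (U · X) ∷ σ (U · X) ∷ []
      ≈⟨ here (sym (σρ-extends X)) ⟩
    σ X ∷ ρ X ∷ μˢ (T · X) ∷ S ▷ σ X ∷ S ▷ μᵘ X ∷ S ▷ κ (U · X) ∷ σ (U · X) ∷ []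
      ≈⟨ there (here (ρ-extension X)) ⟩
    σ X ∷ μᵘ X ∷ ρ (U · X) ∷ σ (U · X) ∷ []
      ≈⟨ there (there (ρσ (U · X))) ⟩
    σ X ∷ μᵘ X ∷ [] ∎

  law : T · S ⇒ S · T
  law = SplitLawData.law (toSplitLawData x)

  open LawComponents 𝐒 𝐓 law

  δ-def : ∀ X → δ X ∷ [] ≈ σ X ∷ μᵘ X ∷ κ (U · X) ∷ T ▷ ι X ∷ []
  δ-def = ≅⇒≈ ↦δ ↦inducedLaw ≅.refl

  -- Composing the law with the multiplication of T replaces ι by ρ.
  law-mult : ∀ X → S ▷ μᵗ X ∷ δ (T · X) ∷ [] ≈ σ X ∷ μᵘ X ∷ κ (U · X) ∷ T ▷ ρ X ∷ []
  law-mult X = begin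
    S ▷ μᵗ X ∷ δ (T · X) ∷ []
      ≈⟨ there (δ-def (T · X)) ⟩
    S ▷ μᵗ X ∷ σ (T · X) ∷ μᵘ (T · X) ∷ κ (U · T · X) ∷ T ▷ ι (T · X) ∷ []
      ≈⟨ here (σ-multʳ X) ⟩
    σ X ∷ μᵘ X ∷ U ▷ κ X ∷ μᵘ (T · X) ∷ κ (U · T · X) ∷ T ▷ ι (T · X) ∷ []
      ≈⟨ there (there (here (U.μ-natural _))) ⟩
    σ X ∷ μᵘ X ∷ μᵘ (U · X) ∷ U ▷ U ▷ κ X ∷ κ (U · T · X) ∷ T ▷ ι (T · X) ∷ []
      ≈⟨ there (here (sym (U.associative X))) ⟩
    σ X ∷ μᵘ X ∷ U ▷ μᵘ X ∷ U ▷ U ▷ κ X ∷ κ (U · T · X) ∷ T ▷ ι (T · X) ∷ []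
      ≈⟨ there (there (there (here (κ-natural _)))) ⟩
    σ X ∷ μᵘ X ∷ U ▷ μᵘ X ∷ κ (U · U · X) ∷ T ▷ U ▷ κ X ∷ T ▷ ι (T · X) ∷ []
      ≈⟨ there (there (here (κ-natural _))) ⟩
    σ X ∷ μᵘ X ∷ κ (U · X) ∷ T ▷ μᵘ X ∷ T ▷ U ▷ κ X ∷ T ▷ ι (T · X) ∷ []
      ≈⟨ there (there (there (there (T ▷≈ ι-natural _)))) ⟩
    σ X ∷ μᵘ X ∷ κ (U · X) ∷ T ▷ μᵘ X ∷ T ▷ ι (U · X) ∷ T ▷ S ▷ κ X ∷ []
      ≈⟨ there (there (there (T ▷≈ sym (ρ-factors X)))) ⟩
    σ X ∷ μᵘ X ∷ κ (U · X) ∷ T ▷ ρ X ∷ [] ∎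

  splits : ∀ X → σ X ∷ ρ X ∷ [] ≈ S ▷ μᵗ X ∷ δ (T · X) ∷ ηᵗ (S · T · X) ∷ []
  splits X = sym (begin
    S ▷ μᵗ X ∷ δ (T · X) ∷ ηᵗ (S · T · X) ∷ []
      ≈⟨ here (law-mult X) ⟩
    σ X ∷ μᵘ X ∷ κ (U · X) ∷ T ▷ ρ X ∷ ηᵗ (S · T · X) ∷ []
      ≈⟨ there (there (there (T.η-natural _))) ⟩
    σ X ∷ μᵘ X ∷ κ (U · X) ∷ ηᵗ (U · X) ∷ ρ X ∷ []
      ≈⟨ there (there (here (κ-unit (U · X)))) ⟩
    σ X ∷ μᵘ X ∷ ηᵘ (U · X) ∷ ρ X ∷ []
      ≈⟨ there (here (U.unitˡ X)) ⟩
    σ X ∷ ρ X ∷ [] ∎)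

  δ-unit : ∀ X → δ X ∷ T ▷ ηˢ X ∷ [] ≈ ηˢ (T · X) ∷ []
  δ-unit X = begin
    δ X ∷ T ▷ ηˢ X ∷ []
      ≈⟨ here (δ-def X) ⟩
    σ X ∷ μᵘ X ∷ κ (U · X) ∷ T ▷ ι X ∷ T ▷ ηˢ X ∷ []
      ≈⟨ there (there (there (T ▷≈ ι-unit X))) ⟩
    σ X ∷ μᵘ X ∷ κ (U · X) ∷ T ▷ ηᵘ X ∷ []
      ≈⟨ there (there (sym (κ-natural _))) ⟩
    σ X ∷ μᵘ X ∷ U ▷ ηᵘ X ∷ κ X ∷ []
      ≈⟨ there (here (U.unitʳ X)) ⟩
    σ X ∷ κ X ∷ []
      ≈⟨ σκ X ⟩
    ηˢ (T · X) ∷ [] ∎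

  δ-multˡ : ∀ X → δ X ∷ T ▷ μˢ X ∷ [] ≈ μˢ (T · X) ∷ S ▷ δ X ∷ δ (S · X) ∷ []
  δ-multˡ X = sym (begin
    μˢ (T · X) ∷ S ▷ δ X ∷ δ (S · X) ∷ []
      ≈⟨ there (here (S ▷≈ δ-def X)) ⟩
    μˢ (T · X) ∷ S ▷ σ X ∷ S ▷ μᵘ X ∷ S ▷ κ (U · X) ∷ S ▷ T ▷ ι X ∷ δ (S · X) ∷ []
      ≈⟨ there (there (there (there (there (δ-def (S · X)))))) ⟩
    μˢ (T · X) ∷ S ▷ σ X ∷ S ▷ μᵘ X ∷ S ▷ κ (U · X) ∷ S ▷ T ▷ ι X ∷
      σ (S · X) ∷ μᵘ (S · X) ∷ κ (U · S · X) ∷ T ▷ ι (S · X) ∷ []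
      ≈⟨ there (there (there (there (here (σ-natural _))))) ⟩
    μˢ (T · X) ∷ S ▷ σ X ∷ S ▷ μᵘ X ∷ S ▷ κ (U · X) ∷ σ (U · X) ∷
      U ▷ ι X ∷ μᵘ (S · X) ∷ κ (U · S · X) ∷ T ▷ ι (S · X) ∷ []
      ≈⟨ here (σ-extension X) ⟩
    σ X ∷ μᵘ X ∷ U ▷ ι X ∷ μᵘ (S · X) ∷ κ (U · S · X) ∷ T ▷ ι (S · X) ∷ []
      ≈⟨ there (there (here (U.μ-natural _))) ⟩
    σ X ∷ μᵘ X ∷ μᵘ (U · X) ∷ U ▷ U ▷ ι X ∷ κ (U · S · X) ∷ T ▷ ι (S · X) ∷ []
      ≈⟨ there (here (sym (U.associative X))) ⟩
    σ X ∷ μᵘ X ∷ U ▷ μᵘ X ∷ U ▷ U ▷ ι X ∷ κ (U · S · X) ∷ T ▷ ι (S · X) ∷ []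
      ≈⟨ there (there (there (here (κ-natural _)))) ⟩
    σ X ∷ μᵘ X ∷ U ▷ μᵘ X ∷ κ (U · U · X) ∷ T ▷ U ▷ ι X ∷ T ▷ ι (S · X) ∷ []
      ≈⟨ there (there (here (κ-natural _))) ⟩
    σ X ∷ μᵘ X ∷ κ (U · X) ∷ T ▷ μᵘ X ∷ T ▷ U ▷ ι X ∷ T ▷ ι (S · X) ∷ []
      ≈⟨ there (there (there (there (T ▷≈ ι-natural _)))) ⟩
    σ X ∷ μᵘ X ∷ κ (U · X) ∷ T ▷ μᵘ X ∷ T ▷ ι (U · X) ∷ T ▷ S ▷ ι X ∷ []
      ≈⟨ there (there (there (T ▷≈ sym (ι-mult X)))) ⟩
    σ X ∷ μᵘ X ∷ κ (U · X) ∷ T ▷ ι X ∷ T ▷ μˢ X ∷ []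
      ≈⟨ here (sym (δ-def X)) ⟩
    δ X ∷ T ▷ μˢ X ∷ [] ∎)

  δ-multʳ : ∀ X → δ X ∷ μᵗ (S · X) ∷ [] ≈ S ▷ μᵗ X ∷ δ (T · X) ∷ T ▷ δ X ∷ []
  δ-multʳ X = begin
    δ X ∷ μᵗ (S · X) ∷ []
      ≈⟨ here (δ-def X) ⟩
    σ X ∷ μᵘ X ∷ κ (U · X) ∷ T ▷ ι X ∷ μᵗ (S · X) ∷ []
      ≈⟨ there (there (there (T.μ-natural _))) ⟩
    σ X ∷ μᵘ X ∷ κ (U · X) ∷ μᵗ (U · X) ∷ T ▷ T ▷ ι X ∷ []
      ≈⟨ there (there (here (κ-mult (U · X)))) ⟩
    σ X ∷ μᵘ X ∷ μᵘ (U · X) ∷ U ▷ κ (U · X) ∷ κ (T · U · X) ∷ T ▷ T ▷ ι X ∷ []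
      ≈⟨ there (here (sym (U.associative X))) ⟩
    σ X ∷ μᵘ X ∷ U ▷ μᵘ X ∷ U ▷ κ (U · X) ∷ κ (T · U · X) ∷ T ▷ T ▷ ι X ∷ []
      ≈⟨ there (there (there (here (κ-natural _)))) ⟩
    σ X ∷ μᵘ X ∷ U ▷ μᵘ X ∷ κ (U · U · X) ∷ T ▷ κ (U · X) ∷ T ▷ T ▷ ι X ∷ []
      ≈⟨ there (there (here (κ-natural _))) ⟩
    σ X ∷ μᵘ X ∷ κ (U · X) ∷ T ▷ μᵘ X ∷ T ▷ κ (U · X) ∷ T ▷ T ▷ ι X ∷ []
      ≈⟨ there (there (there (here (T ▷≈ sym (ρσ X))))) ⟩
    σ X ∷ μᵘ X ∷ κ (U · X) ∷ T ▷ ρ X ∷ T ▷ σ X ∷ T ▷ μᵘ X ∷ T ▷ κ (U · X) ∷ T ▷ T ▷ ι X ∷ []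
      ≈⟨ there (there (there (there (T ▷≈ sym (δ-def X))))) ⟩
    σ X ∷ μᵘ X ∷ κ (U · X) ∷ T ▷ ρ X ∷ T ▷ δ X ∷ []
      ≈⟨ here (sym (law-mult X)) ⟩
    S ▷ μᵗ X ∷ δ (T · X) ∷ T ▷ δ X ∷ [] ∎

  recovers-μ : ∀ X →
    ρ X ∷ S ▷ μᵗ X ∷ μˢ (T · T · X) ∷ S ▷ δ (T · X) ∷ σ (S · T · X) ∷ U ▷ σ X ∷ [] ≈ μᵘ X ∷ []
  recovers-μ X = begin
    ρ X ∷ S ▷ μᵗ X ∷ μˢ (T · T · X) ∷ S ▷ δ (T · X) ∷ σ (S · T · X) ∷ U ▷ σ X ∷ []
      ≈⟨ there (here (S.μ-natural _)) ⟩
    ρ X ∷ μˢ (T · X) ∷ S ▷ S ▷ μᵗ X ∷ S ▷ δ (T · X) ∷ σ (S · T · X) ∷ U ▷ σ X ∷ []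
      ≈⟨ there (there (here (S ▷≈ law-mult X))) ⟩
    ρ X ∷ μˢ (T · X) ∷ S ▷ σ X ∷ S ▷ μᵘ X ∷ S ▷ κ (U · X) ∷ S ▷ T ▷ ρ X ∷
      σ (S · T · X) ∷ U ▷ σ X ∷ []
      ≈⟨ here (ρ-extension X) ⟩
    μᵘ X ∷ ρ (U · X) ∷ S ▷ T ▷ ρ X ∷ σ (S · T · X) ∷ U ▷ σ X ∷ []
      ≈⟨ there (there (here (σ-natural _))) ⟩
    μᵘ X ∷ ρ (U · X) ∷ σ (U · X) ∷ U ▷ ρ X ∷ U ▷ σ X ∷ []
      ≈⟨ there (here (ρσ (U · X))) ⟩
    μᵘ X ∷ U ▷ ρ X ∷ U ▷ σ X ∷ []
      ≈⟨ there (U ▷≈ ρσ X) ⟩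
    μᵘ X ∷ [] ∎

  splitLaw : SplitWeakDistributiveLaw K C
  splitLaw = record
    { S = 𝐒
    ; T = 𝐓
    ; U = U
    ; law = law
    ; r = r
    ; s = s
    ; isWeakDistributiveLaw = record
      { law-unit  = Equivalence.from law-unit⇔ δ-unit
      ; law-multˡ = Equivalence.from law-multˡ⇔ δ-multˡ
      ; law-multʳ = Equivalence.from law-multʳ⇔ δ-multʳ
      }
    ; isSplitting = record
      { retraction = D.retraction
      ; splits     = ≅.≅-to-≡ (≈⇒≅ ↦idem ↦lawIdempotent splits)
      }
    }

  monad-recovered : RetractionData.U (toRetractionData splitLaw) ≡ Monad.raw 𝐔
  monad-recovered = cong₂ (rawMonad U)
    (≅.≅-to-≡ (≈⇒≅ (FromLaw.↦inducedUnit splitLaw) U.↦η ρ-unit))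
    (≅.≅-to-≡ (≈⇒≅ (FromLaw.↦inducedMult splitLaw) U.↦μ recovers-μ))

-- Both constructions are mutually inverse

module _ {o ℓ e} {K : Strict2Category o ℓ e} {C : Strict2Category.Obj K} where
  open Strict2Category K
  open Monad using (raw) renaming (cell to ⟨_⟩)

  -- The laws are propositions, so the tuples are determined by their data.
  isMonad-irrelevant : {M : RawMonad K C} (p q : IsMonad K C M) → p ≡ q
  isMonad-irrelevant p q
    with ≅.≅-irrelevant (P.unitʳ p) (P.unitʳ q)
       | ≅.≅-irrelevant (P.unitˡ p) (P.unitˡ q)
       | ≅.≅-irrelevant (P.assocᴹ p) (P.assocᴹ q)
    where
    module P = IsMonad
  ... | ≡.refl | ≡.refl | ≡.refl = ≡.refl

  isWeakDistributiveLaw-irrelevant : {S T : Monad K C} {law : ⟨ T ⟩ · ⟨ S ⟩ ⇒ ⟨ S ⟩ · ⟨ T ⟩}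
    (p q : IsWeakDistributiveLaw S T law) → p ≡ q
  isWeakDistributiveLaw-irrelevant p q
    with ≅.≅-irrelevant (P.law-unit p) (P.law-unit q)
       | ≅.≅-irrelevant (P.law-multˡ p) (P.law-multˡ q)
       | ≅.≅-irrelevant (P.law-multʳ p) (P.law-multʳ q)
    where
    module P = IsWeakDistributiveLaw
  ... | ≡.refl | ≡.refl | ≡.refl = ≡.refl

  isSplitting-irrelevant : {F U : C ⇛ C} {idem : F ⇒ F} {r : F ⇒ U} {s : U ⇒ F}
    (p q : IsSplitting {K = K} idem r s) → p ≡ q
  isSplitting-irrelevant p q
    with ≡-irrelevant (P.retraction p) (P.retraction q)
       | ≡-irrelevant (P.splits p) (P.splits q)
    where
    module P = IsSplitting
  ... | ≡.refl | ≡.refl = ≡.refl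

  isDistributingRetraction-irrelevant : {S T U : Monad K C}
    {r : ⟨ S ⟩ · ⟨ T ⟩ ⇒ ⟨ U ⟩} {s : ⟨ U ⟩ ⇒ ⟨ S ⟩ · ⟨ T ⟩}
    (p q : IsDistributingRetraction S T U r s) → p ≡ q
  isDistributingRetraction-irrelevant p q
    with ≡-irrelevant (P.retraction p) (P.retraction q)
       | ≅.≅-irrelevant (P.r-unit p) (P.r-unit q)
       | ≅.≅-irrelevant (P.r-multˡ p) (P.r-multˡ q)
       | ≅.≅-irrelevant (P.r-multʳ p) (P.r-multʳ q)
       | ≡-irrelevant (P.idem-unit p) (P.idem-unit q)
       | ≅.≅-irrelevant (P.idem-mult p) (P.idem-mult q)
       | ≅.≅-irrelevant (P.idem-extends p) (P.idem-extends q)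
    where
    module P = IsDistributingRetraction
  ... | ≡.refl | ≡.refl | ≡.refl | ≡.refl | ≡.refl | ≡.refl | ≡.refl = ≡.refl

  underlyingSplitLaw-injective : (y z : SplitWeakDistributiveLaw K C) →
    underlyingSplitLaw y ≡ underlyingSplitLaw z → y ≡ z
  underlyingSplitLaw-injective
    record { isWeakDistributiveLaw = w ; isSplitting = p }
    record { isWeakDistributiveLaw = w′ ; isSplitting = p′ } ≡.refl
    with isWeakDistributiveLaw-irrelevant w w′ | isSplitting-irrelevant p p′
  ... | ≡.refl | ≡.refl = ≡.refl

  underlyingRetraction-injective : (x z : DistributingRetraction K C) →
    underlyingRetraction x ≡ underlyingRetraction z → x ≡ z
  underlyingRetraction-injective
    record { U = record { isMonad = m } ; isDistributingRetraction = d }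
    record { U = record { isMonad = m′ } ; isDistributingRetraction = d′ } ≡.refl
    with isMonad-irrelevant m m′
  ... | ≡.refl with isDistributingRetraction-irrelevant d d′
  ... | ≡.refl = ≡.refl

  retraction-recovered : (x : DistributingRetraction K C) →
    FromLaw.retraction (FromRetraction.splitLaw x) ≡ x
  retraction-recovered x = underlyingRetraction-injective _ x
    (recover (FromRetraction.monad-recovered x))
    where
    open DistributingRetraction x
    -- Stated for arbitrary η and μ, since r and s depend on the 1-cell of the monad.
    recover : {η : id₁ ⇒ ⟨ U ⟩} {μ : ⟨ U ⟩ · ⟨ U ⟩ ⇒ ⟨ U ⟩} → rawMonad ⟨ U ⟩ η μ ≡ raw U →
              retractionData S T (rawMonad ⟨ U ⟩ η μ) r s ≡ underlyingRetraction x
    recover ≡.refl = ≡.refl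

  splitLaw-recovered : (y : SplitWeakDistributiveLaw K C) →
    FromRetraction.splitLaw (FromLaw.retraction y) ≡ y
  splitLaw-recovered y = underlyingSplitLaw-injective _ y
    (cong (λ law → splitLawData S T U law r s) (FromLaw.law-recovered y))
    where open SplitWeakDistributiveLaw y using (S; T; U; r; s)

mainTheorem1 : ∀ {o ℓ e} (K : Strict2Category o ℓ e) (C : Strict2Category.Obj K) →
    Σ[ φ ∈ (DistributingRetraction K C ↔ SplitWeakDistributiveLaw K C) ]
    ((∀ x → underlyingSplitLaw (Inverse.to φ x) ≡ toSplitLawData x) ×
    (∀ y → underlyingRetraction (Inverse.from φ y) ≡ toRetractionData y))
mainTheorem1 K C =
  mk↔ₛ′ FromRetraction.splitLaw FromLaw.retraction splitLaw-recovered retraction-recovered ,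
  (λ x → ≡.refl) , (λ y → ≡.refl)
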